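{- Consider inputs consisting of a connected graph $G=(V,E)$, a graph $G'=(V,E')$ with $E\subseteq E'$, and a consistent partial function $\tilde x\in\tilde X_{GG'}$. Maximal specificity of $\tilde x$, i.e., whether $E'[\tilde x]\subseteq\operatorname{dom}\tilde x$, can be decided in polynomial time if $E'=E$ or $E\subseteq\operatorname{dom}\tilde x$.
   Context: All graphs are finite, simple and undirected; an edge $\{v,w\}$ is also written $vw$. Paths and cycles have no repeated nodes and are identified with their edge sets. For a graph $G=(V,E)$ and distinct $v,w\in V$, $vw\text{ -paths}(G)$ is the set of all paths in $G$ from $v$ to $w$; a $vw$-cut of $G$ is an inclusion-minimal set $C\subseteq E$ such that $v$ and $w$ are not connected in $(V,E\setminus C)$, and $vw\text{ -cuts}(G)$ is the set of all of these. For a connected graph $G=(V,E)$ and a graph $G'=(V,E')$ with $E\subseteq E'$, let $F_{GG'}:=E'\setminus E$ and let $X_{GG'}$ be the set of all $x\in\{0,1\}^{E'}$ such that (i) $x_e\le\sum_{e'\in C\setminus\{e\}}x_{e'}$ for every cycle $C$ of $G$ and every $e\in C$; (ii) $x_{vw}\le\sum_{e\in P}x_e$ for every $vw\in F_{GG'}$ and every $P\in vw\text{ -paths}(G)$; (iii) $1-x_{vw}\le\sum_{e\in C}(1-x_e)$ for every $vw\in F_{GG'}$ and every $C\in vw\text{ -cuts}(G)$. $\{0,1,*\}^{E'}:=\bigcup_{F\subseteq E'}\{0,1\}^F$ is the set of partial functions from $E'$ to $\{0,1\}$; $\operatorname{dom}\tilde x$ denotes the domain of $\tilde x$. Let $X_{GG'}[\tilde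 x]:=\{x\in X_{GG'}\mid \forall e\in\operatorname{dom}\tilde x:\ x_e=\tilde x_e\}$ and $\tilde X_{GG'}:=\{\tilde x\in\{0,1,*\}^{E'}\mid X_{GG'}[\tilde x]\ne\emptyset\}$. For $\tilde x\in\tilde X_{GG'}$, the set of decided edges is $E'[\tilde x]:=\{e\in E'\mid\forall x,x'\in X_{GG'}[\tilde x]:\ x_e=x'_e\}$. -}

module Defs where

open import Data.Bool.Base using (Bool; true; false)
open import Data.Fin.Base using (Fin; toℕ; _<_)
open import Data.Fin.Subset using (Subset; inside; outside; _∈_; _⊆_; _─_; _-_; ∁; ⋃; ⁅_⁆)
open import Data.List.Base using (List; []; _∷_; _++_; length; map; concatMap; allFin)
open import Data.List.Relation.Unary.Unique.Propositional using (Unique)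
open import Data.Maybe.Base using (Maybe; just; nothing)
open import Data.Nat.Base using (ℕ; zero; suc; _+_; _*_; _∸_; _^_; _≤_)
open import Data.Nat.Binary.Base using (ℕᵇ; 2[1+_]; 1+[2_]; fromℕ)
open import Data.Fin.Patterns using (0F; 1F)
open import Data.Nat.GeneralisedArithmetic using (iterate)
open import Data.Product.Base using (∃; ∃₂; _×_; _,_; proj₁; proj₂)
open import Data.Sum.Base using (_⊎_)
open import Data.Vec.Base as Vec using (Vec)
open import Function.Base using (_∘_)
open import Function.Bundles using (_↔_; _↣_; _⇔_; module Injection)
open import Function.Definitions using (Injective)
open import Relation.Binary.PropositionalEquality.Core using (_≡_)
open import Relation.Nullary.Negation.Core using (¬_)

-- A finite simple graph with nodes Fin n whose edges are enumerated by Fin m.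
-- The unordered pair {v,w} is represented by (v , w) with v < w.

record Graph : Set where
  field
    n m       : ℕ
    ends      : Fin m → Fin n × Fin n
    ordered   : ∀ e → proj₁ (ends e) < proj₂ (ends e)
    injective : Injective _≡_ _≡_ ends

module _ (G′ : Graph) where
  open Graph G′

  Joins : Fin m → Fin n → Fin n → Set
  Joins e v w = ends e ≡ (v , w) ⊎ ends e ≡ (w , v)

  data Walk (S : Subset m) : Fin n → Fin n → Set where
    []   : ∀ {v} → Walk S v v
    step : ∀ {u v w} (e : Fin m) → e ∈ S → Joins e u v → Walk S v w → Walk S u w

-- The nodes of a walk except for its first node.

targets : ∀ {G′ S v w} → Walk G′ S v w → List (Fin (Graph.n G′))
targets []                     = []
targets (step {v = v} _ _ _ p) = v ∷ targets p

edges : ∀ {G′ S v w} → Walk G′ S v w → List (Fin (Graph.m G′))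
edges []             = []
edges (step e _ _ p) = e ∷ edges p

edgeSet : ∀ {G′ S v w} → Walk G′ S v w → Subset (Graph.m G′)
edgeSet p = ⋃ (map ⁅_⁆ (edges p))

∑ : ∀ {m} → Subset m → (Fin m → ℕ) → ℕ
∑ Vec.[]            f = 0
∑ (inside  Vec.∷ S) f = f 0F + ∑ S (f ∘ Fin.suc)
∑ (outside Vec.∷ S) f = ∑ S (f ∘ Fin.suc)

module _ (G′ : Graph) where
  open Graph G′

  -- In all of the following, S stands for the graph (Fin n , S).

  IsPath : Subset m → Fin n → Fin n → Subset m → Set
  IsPath S v w P = ∃ λ (p : Walk G′ S v w) → Unique (v ∷ targets p) × edgeSet p ≡ P

  IsCycle : Subset m → Subset m → Set
  IsCycle S C = ∃₂ λ v (p : Walk G′ S v v) →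
    Unique (targets p) × 3 ≤ length (edges p) × edgeSet p ≡ C

  NodesConnected : Subset m → Fin n → Fin n → Set
  NodesConnected S v w = ∃ λ P → IsPath S v w P

  Connected : Subset m → Set
  Connected S = ∀ v w → NodesConnected S v w

  Separates : Subset m → Fin n → Fin n → Subset m → Set
  Separates S v w C = ¬ NodesConnected (S ─ C) v w

  IsCut : Subset m → Fin n → Fin n → Subset m → Set
  IsCut S v w C = C ⊆ S × Separates S v w C
                × (∀ D → D ⊆ C → Separates S v w D → C ⊆ D)

  -- X E is the set X_GG′ for G = (Fin n , E).

  record X (E : Subset m) (x : Fin m → Fin 2) : Set where
    field
      cycle : ∀ C → IsCycle E C → ∀ e → e ∈ C →
              toℕ (x e) ≤ ∑ (C - e) (toℕ ∘ x)
      path  : ∀ f → f ∈ ∁ E → let (v , w) = ends f in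
              ∀ P → IsPath E v w P → toℕ (x f) ≤ ∑ P (toℕ ∘ x)
      cut   : ∀ f → f ∈ ∁ E → let (v , w) = ends f in
              ∀ C → IsCut E v w C → 1 ∸ toℕ (x f) ≤ ∑ C (λ e → 1 ∸ toℕ (x e))

Partial : ℕ → Set
Partial m = Fin m → Maybe (Fin 2)

_∈dom_ : ∀ {m} → Fin m → Partial m → Set
e ∈dom x̃ = ∃ λ b → x̃ e ≡ just b

module _ (G′ : Graph) (E : Subset (Graph.m G′)) (x̃ : Partial (Graph.m G′)) where
  open Graph G′

  X[_] : (Fin m → Fin 2) → Set
  X[_] x = X G′ E x × (∀ e b → x̃ e ≡ just b → x e ≡ b)

  Consistent : Set
  Consistent = ∃ λ x → X[_] x

  Decided : Fin m → Set
  Decided e = ∀ x x′ → X[_] x → X[_] x′ → x e ≡ x′ e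

record Input : Set where
  field
    G′         : Graph
    E          : Subset (Graph.m G′)
    connected  : Connected G′ E
    x̃          : Partial (Graph.m G′)
    consistent : Consistent G′ E x̃

MaximallySpecific : Input → Set
MaximallySpecific I = ∀ e → Decided G′ E x̃ e → e ∈dom x̃
  where open Input I

data Symbol : Set where
  one two end yes no val0 val1 val* : Symbol

-- Bijective base-2 numerals, least significant digit first.

encodeℕᵇ : ℕᵇ → List Symbol
encodeℕᵇ ℕᵇ.zero  = end ∷ []
encodeℕᵇ 1+[2 b ] = one ∷ encodeℕᵇ b
encodeℕᵇ 2[1+ b ] = two ∷ encodeℕᵇ b

encodeℕ : ℕ → List Symbol
encodeℕ = encodeℕᵇ ∘ fromℕ

encodeFlag : Bool → Symbol
encodeFlag true  = yes
encodeFlag false = no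

encodeValue : Maybe (Fin 2) → Symbol
encodeValue (just 0F) = val0
encodeValue (just 1F) = val1
encodeValue nothing   = val*

encodeEdge : (I : Input) → Fin (Graph.m (Input.G′ I)) → List Symbol
encodeEdge I e =
  encodeℕ (toℕ (proj₁ (ends e))) ++ encodeℕ (toℕ (proj₂ (ends e))) ++
  encodeFlag (Vec.lookup E e) ∷ encodeValue (x̃ e) ∷ []
  where
  open Input I
  open Graph G′

-- The number of nodes, followed by the list of edges of G′, each given by
-- its two ends, a flag for membership in E, and its value under x̃.

encode : Input → List Symbol
encode I = encodeℕ n ++ concatMap (encodeEdge I) (allFin m)
  where
  open Input I
  open Graph G′

data Move : Set where
  left stay right : Move

Finite : Set → Set
Finite A = ∃ λ k → A ↔ Fin k

-- The machine has 1 + k two-way infinite tapes.  The embedding maps nothing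
-- to the blank symbol.  A state q is halting, with answer b, if
-- verdict q ≡ just b.

record TM (Σ : Set) : Set₁ where
  field
    k         : ℕ
    State     : Set
    Γ         : Set
    State-fin : Finite State
    Γ-fin     : Finite Γ
    embed     : Maybe Σ ↣ Γ
    start     : State
    verdict   : State → Maybe Bool
    δ         : State → Vec Γ (suc k) → State × Vec (Γ × Move) (suc k)

module Run {Σ : Set} (M : TM Σ) where
  open TM M

  blank : Γ
  blank = Injection.to embed nothing

  -- The cells to the left of the head are listed from right to left; all
  -- cells not listed are blank.

  record Tape : Set where
    constructor tape
    field
      before : List Γ
      head   : Γ
      after  : List Γ

  emptyTape : Tape
  emptyTape = tape [] blank []

  inputTape : List Σ → Tape
  inputTape []      = emptyTape
  inputTape (a ∷ w) = tape [] (symbol a) (map symbol w)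
    where
    symbol : Σ → Γ
    symbol = Injection.to embed ∘ just

  move : Move → Tape → Tape
  move left  (tape []       b rs)       = tape [] blank (b ∷ rs)
  move left  (tape (a ∷ ls) b rs)       = tape ls a (b ∷ rs)
  move stay  t                          = t
  move right (tape ls       b [])       = tape (b ∷ ls) blank []
  move right (tape ls       b (c ∷ rs)) = tape (b ∷ ls) c rs

  act : Γ × Move → Tape → Tape
  act (a , d) (tape ls _ rs) = move d (tape ls a rs)

  Config : Set
  Config = State × Vec Tape (suc k)

  initial : List Σ → Config
  initial w = start , inputTape w Vec.∷ Vec.replicate k emptyTape

  next : Config → Config
  next (q , ts) with verdict q
  ... | just _  = q , ts
  ... | nothing = let (q′ , as) = δ q (Vec.map Tape.head ts)
                  in  q′ , Vec.zipWith act as ts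

  -- The answer, if any, given on input w after at most t steps.

  answer : List Σ → ℕ → Maybe Bool
  answer w t = verdict (proj₁ (iterate next (initial w) t))

-- A promise problem: nothing is required of the machine on other inputs.

DecidableInPolynomialTime :
  {Σ I : Set} → (I → List Σ) → (promise P : I → Set) → Set₁
DecidableInPolynomialTime {Σ} {I} enc promise P =
  ∃ λ (M : TM Σ) → ∃₂ λ c d → ∀ i → promise i →
    ∃ λ b → Run.answer M (enc i) (c * length (enc i) ^ d + c) ≡ just b
          × (b ≡ true ⇔ P i)

{-# OPTIONS --safe #-}

-- If E = E′, then X consists of the labellings which are 0 within and 1
-- between the blocks of a partition of the nodes.  Hence an edge outside the
-- domain of x̃ is decided iff its ends lie in the same component of the edges
-- labelled 0, or in two such components that an edge labelled 1 joins.  If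
-- E ⊆ dom x̃, then all edges are decided: a path of zeros forces the label 0,
-- and without such a path the edges of E labelled 1 contain a cut, which
-- forces the label 1.  So in both cases x̃ is maximally specific iff each
-- edge outside its domain lies in E and is not decided for one of the first
-- two reasons.  A machine contracts the edges labelled 0 one by one, by
-- replacing the name of one end by that of the other in the whole list of
-- edges, and then compares the names of the ends of the other edges.

module Submission where

open import Defs
open import Data.Bool.Base using (Bool; true; false; if_then_else_; _∧_)
open import Data.Bool.ListAction using (any; all)
open import Data.Fin.Base using (Fin; toℕ; _<_; _↑ʳ_)
open import Data.Fin.Patterns
open import Data.Fin.Properties using (_≟_; 2↔Bool; 1↔⊤; +↔⊎; *↔×; <-asym; <-irrefl; toℕ<n; toℕ-injective)
open import Data.Fin.Subset using (Subset; ⊤; _∈_; _∉_; _⊆_; _─_; _-_; ∁; ∣_∣; inside; outside)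
open import Data.Fin.Subset.Properties using (∉⊥; ∈⊤; x∈p∪q⁻; x∈p∪q⁺; x∈⁅x⁆; x∈⁅y⁆⇒x≡y; p─q⊆p; x∈∁p⇒x∉p; x∉p⇒x∈∁p; x∈p∧x≢y⇒x∈p-y; p⊂q⇒∣p∣<∣q∣) renaming (_∈?_ to _∈S?_)
open import Data.List.Base as List using (List; []; _∷_; _++_; _ʳ++_; length; map; reverse; drop; replicate; concatMap; allFin)
open import Data.List.Membership.DecPropositional using (_∈?_)
open import Data.List.Membership.Propositional using () renaming (_∈_ to _∈ₗ_; _∉_ to _∉ₗ_)
open import Data.List.Membership.Propositional.Properties using (∈-++⁺ˡ; ∈-++⁺ʳ; ∈-++⁻; ∈-map⁺; ∈-map⁻; ∈-allFin)
open import Data.List.Properties using (++-assoc; ++-identityʳ; ∷-injectiveʳ; reverse-involutive; length-++; length-reverse; length-map; map-id)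
open import Data.List.Relation.Unary.All as All using (All; []; _∷_)
open import Data.List.Relation.Unary.All.Properties using (map⁺; ¬Any⇒All¬; All¬⇒¬Any)
open import Data.List.Relation.Unary.AllPairs using ([]; _∷_)
open import Data.List.Relation.Unary.Any using (here; there)
open import Data.List.Relation.Unary.Unique.Propositional using (Unique)
open import Data.Maybe.Base using (Maybe; just; nothing)
open import Data.Nat.Base using (ℕ; zero; suc; _+_; _*_; _^_; _∸_; _≤_; z≤n; s≤s)
open import Data.Nat.Binary.Base as ℕᵇ using (ℕᵇ; 2[1+_]; 1+[2_]; fromℕ; fromℕ')
open import Data.Nat.Binary.Properties using (fromℕ-injective; fromℕ≡fromℕ')
open import Data.Nat.GeneralisedArithmetic using (iterate)
open import Data.Nat.Properties hiding (_≟_; <-asym; <-irrefl)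
open import Data.Nat.Tactic.RingSolver using (solve-∀)
open import Data.Product.Base using (Σ; ∃; ∃₂; _×_; _,_; proj₁; proj₂)
open import Data.Product.Function.Dependent.Propositional using (Σ-↔)
open import Data.Product.Function.NonDependent.Propositional using (_×-↔_)
open import Data.Sum.Base as Sum using (_⊎_; inj₁; inj₂)
open import Data.Sum.Function.Propositional using (_⊎-↔_)
open import Data.Unit.Base using (tt) renaming (⊤ to Unit)
open import Data.Vec.Base as Vec using (Vec; []; _∷_; here; there; lookup; _[_]≔_)
open import Data.Vec.Properties using (lookup-zipWith; lookup-map; lookup-replicate; lookup∘tabulate; lookup∘update; lookup∘update′; []≔-idempotent; []≔-commutes; []≔-lookup; []=⇒lookup; lookup⇒[]=)
open import Function.Base using (_∘_; id)
open import Function.Bundles using (_↔_; _⇔_; mk↔ₛ′; mk↣; mk⇔; module Inverse; module Equivalence)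
open import Function.Properties.Inverse using (↔-refl; ↔-sym; ↔-trans)
open import Relation.Binary.PropositionalEquality hiding ([_])
open import Relation.Nullary using (¬_; contradiction) renaming (yes to yea; no to nay)
open import Relation.Nullary.Decidable using (does; dec-true)

-- Stack machines

-- Which half of the promise holds is not part of the input, so one test has to serve both; under E
-- ⊆ dom x̃ it degenerates, since x̃ is then maximally specific only if it is total. No completion
-- is ever searched for: forced labels follow from the inequalities, and the freedom of the
-- remaining edges is witnessed by two explicit partitions, read off from the names after
-- contraction. Consistency is what makes these partitions respect the edges labelled 1. The
-- obstacle is the machine model. Programs are therefore written for stacks, composed of small
-- pieces whose running times add up, and translated to tapes once and for all, at two steps per
-- instruction. Contraction by renaming suits stacks: it needs no addresses, and as a name is only
-- ever replaced by another existing name, names never outgrow the input. Each of linearly many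
-- contractions rewrites linearly many names of at most linear length, and each remaining edge is
-- compared to linearly many others; hence the exponent 3 in the time bound.

finite-⊎ : ∀ {A B} → Finite A → Finite B → Finite (A ⊎ B)
finite-⊎ (k , f) (l , g) = k + l , ↔-trans (f ⊎-↔ g) (↔-sym +↔⊎)

finite-× : ∀ {A B} → Finite A → Finite B → Finite (A × B)
finite-× (k , f) (l , g) = k * l , ↔-trans (f ×-↔ g) (↔-sym *↔×)

finite-ΣFin : ∀ k {B : Fin k → Set} → (∀ i → Finite (B i)) → Finite (Σ (Fin k) B)
finite-ΣFin zero    fin = 0 , mk↔ₛ′ (λ { (() , _) }) (λ ()) (λ ()) (λ { (() , _) })
finite-ΣFin (suc k) {B} fin =
  let l , f = finite-⊎ (fin 0F) (finite-ΣFin k (fin ∘ Fin.suc)) in l , ↔-trans split f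
  where
  split : Σ (Fin (suc k)) B ↔ (B 0F ⊎ Σ (Fin k) (B ∘ Fin.suc))
  split = mk↔ₛ′
    (λ { (0F , b) → inj₁ b ; (Fin.suc i , b) → inj₂ (i , b) })
    (λ { (inj₁ b) → 0F , b ; (inj₂ (i , b)) → Fin.suc i , b })
    (λ { (inj₁ b) → refl ; (inj₂ (i , b)) → refl })
    (λ { (0F , b) → refl ; (Fin.suc i , b) → refl })

-- Needed for sequencing: the program run second depends on the result of the first, so the states
-- form a dependent sum.
finite-Σ : ∀ {A} {B : A → Set} → Finite A → (∀ a → Finite (B a)) → Finite (Σ A B)
finite-Σ (k , f) fin =
  let l , g = finite-ΣFin k (fin ∘ Inverse.from f)
  in  l , ↔-trans (↔-sym (Σ-↔ (↔-sym f) ↔-refl)) g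

instance
  finite-⊤ : Finite Unit
  finite-⊤ = 1 , ↔-sym 1↔⊤

  finite-Bool : Finite Bool
  finite-Bool = 2 , ↔-sym 2↔Bool

  finite-MaybeSymbol : Finite (Maybe Symbol)
  finite-MaybeSymbol = 9 , mk↔ₛ′ to from to∘from from∘to
    where
    to : Maybe Symbol → Fin 9
    to nothing     = 0F
    to (just one)  = 1F
    to (just two)  = 2F
    to (just end)  = 3F
    to (just yes)  = 4F
    to (just no)   = 5F
    to (just val0) = 6F
    to (just val1) = 7F
    to (just val*) = 8F
    from : Fin 9 → Maybe Symbol
    from 0F = nothing
    from 1F = just one
    from 2F = just two
    from 3F = just end
    from 4F = just yes
    from 5F = just no
    from 6F = just val0
    from 7F = just val1
    from 8F = just val*
    to∘from : ∀ i → to (from i) ≡ i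
    to∘from 0F = refl
    to∘from 1F = refl
    to∘from 2F = refl
    to∘from 3F = refl
    to∘from 4F = refl
    to∘from 5F = refl
    to∘from 6F = refl
    to∘from 7F = refl
    to∘from 8F = refl
    from∘to : ∀ c → from (to c) ≡ c
    from∘to nothing     = refl
    from∘to (just one)  = refl
    from∘to (just two)  = refl
    from∘to (just end)  = refl
    from∘to (just yes)  = refl
    from∘to (just no)   = refl
    from∘to (just val0) = refl
    from∘to (just val1) = refl
    from∘to (just val*) = refl

module _ {k : ℕ} where

  Stacks : Set
  Stacks = Vec (List Symbol) (suc k)

  data Instr (Q : Set) : Set where
    pop  : Fin (suc k) → (Maybe Symbol → Q) → Instr Q
    push : Fin (suc k) → Symbol → Q → Instr Q
    nop  : Q → Instr Q

  exec : ∀ {Q} → Instr Q → Stacks → Q × Stacks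
  exec (pop i κ)    σ = κ (List.head (lookup σ i)) , σ [ i ]≔ drop 1 (lookup σ i)
  exec (push i c q) σ = q , σ [ i ]≔ (c ∷ lookup σ i)
  exec (nop q)      σ = q , σ

  mapInstr : ∀ {Q Q′} → (Q → Q′) → Instr Q → Instr Q′
  mapInstr f (pop i κ)    = pop i (f ∘ κ)
  mapInstr f (push i c q) = push i c (f q)
  mapInstr f (nop q)      = nop (f q)

  exec-map : ∀ {Q Q′} (f : Q → Q′) I σ {q σ′} →
             exec I σ ≡ (q , σ′) → exec (mapInstr f I) σ ≡ (f q , σ′)
  exec-map f (pop i κ)    σ refl = refl
  exec-map f (push i c q) σ refl = refl
  exec-map f (nop q)      σ refl = refl

-- A machine with k + 1 stacks, which exits with a result in R.

record Machine (k : ℕ) (R : Set) : Set₁ where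
  no-eta-equality
  field
    State  : Set
    finite : Finite State
    start  : State
    instr  : State → Instr {k} (State ⊎ R)

open Machine using (start)

module _ {k : ℕ} {R : Set} where

  module _ (M : Machine k R) where
    open Machine M hiding (start)

    -- The number is only an upper bound on the length of the run.
    data Steps : State → Stacks {k} → ℕ → R → Stacks {k} → Set where
      exit : ∀ {s σ t r σ′} →
             exec (instr s) σ ≡ (inj₂ r , σ′) → Steps s σ (suc t) r σ′
      more : ∀ {s σ t r s′ σ′ σ″} →
             exec (instr s) σ ≡ (inj₁ s′ , σ′) → Steps s′ σ′ t r σ″ →
             Steps s σ (suc t) r σ″

  infix 0 _∶_⟶[_]_,_
  _∶_⟶[_]_,_ : Machine k R → Stacks {k} → ℕ → R → Stacks {k} → Set
  M ∶ σ ⟶[ t ] r , σ′ = Steps M (start M) σ t r σ′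

  slower : ∀ {M s σ t t′ r σ′} → t ≤ t′ → Steps M s σ t r σ′ → Steps M s σ t′ r σ′
  slower (s≤s _)    (exit eq)   = exit eq
  slower (s≤s t≤t′) (more eq p) = more eq (slower t≤t′ p)

  primitive₁ : Instr {k} R → Machine k R
  primitive₁ I = record
    { State = Unit ; finite = finite-⊤ ; start = tt ; instr = λ _ → mapInstr inj₂ I }

  run-primitive₁ : ∀ I {σ r σ′} → exec I σ ≡ (r , σ′) → primitive₁ I ∶ σ ⟶[ 1 ] r , σ′
  run-primitive₁ I {σ} eq = exit (exec-map inj₂ I σ eq)

module _ {k : ℕ} {R R′ : Set} ⦃ fin : Finite R ⦄ (M : Machine k R) (N : R → Machine k R′) where

  -- Handing over costs no step: the exiting instruction of `M` leads straight to the start of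
  -- `N r`, so that times simply add up.
  bind : Machine k R′
  bind = record
    { State  = Machine.State M ⊎ Σ R (Machine.State ∘ N)
    ; finite = finite-⊎ (Machine.finite M) (finite-Σ fin (Machine.finite ∘ N))
    ; start  = inj₁ (start M)
    ; instr  = λ where
        (inj₁ s)       → mapInstr (λ q → inj₁ (Sum.map₂ (λ r → r , start (N r)) q)) (Machine.instr M s)
        (inj₂ (r , s)) → mapInstr (Sum.map₁ (λ s′ → inj₂ (r , s′))) (Machine.instr (N r) s)
    }

  run-second : ∀ {r s σ t r′ σ′} → Steps (N r) s σ t r′ σ′ → Steps bind (inj₂ (r , s)) σ t r′ σ′
  run-second {r} {s} {σ} (exit eq)   = exit (exec-map _ (Machine.instr (N r) s) σ eq)
  run-second {r} {s} {σ} (more eq p) =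
    more (exec-map _ (Machine.instr (N r) s) σ eq) (run-second p)

  run-first : ∀ {s σ t r σ′ t′ r′ σ″} → Steps M s σ t r σ′ → N r ∶ σ′ ⟶[ t′ ] r′ , σ″ →
              Steps bind (inj₁ s) σ (t + t′) r′ σ″
  run-first {s} {σ} (exit {t = t} eq) p′ =
    more (exec-map _ (Machine.instr M s) σ eq) (slower (m≤n+m _ t) (run-second p′))
  run-first {s} {σ} (more eq p) p′ =
    more (exec-map _ (Machine.instr M s) σ eq) (run-first p p′)

module _ {k : ℕ} {R : Set} (M : Machine k (Maybe R)) where

  private
    again : Machine.State M ⊎ Maybe R → Machine.State M ⊎ R
    again (inj₁ s)        = inj₁ s
    again (inj₂ nothing)  = inj₁ (start M)
    again (inj₂ (just r)) = inj₂ r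

  -- The body reports `nothing` to be run again and `just r` to leave the loop. No bound on the
  -- rounds is built in; each run lemma supplies one by induction on the data.
  iteration : Machine k R
  iteration = record
    { State  = Machine.State M
    ; finite = Machine.finite M
    ; start  = start M
    ; instr  = λ s → mapInstr again (Machine.instr M s)
    }

  iteration-last : ∀ {s σ t r σ′} → Steps M s σ t (just r) σ′ → Steps iteration s σ t r σ′
  iteration-last {s} {σ} (exit eq)   = exit (exec-map _ (Machine.instr M s) σ eq)
  iteration-last {s} {σ} (more eq p) =
    more (exec-map _ (Machine.instr M s) σ eq) (iteration-last p)

  iteration-again : ∀ {s σ t σ′ t′ r σ″} → Steps M s σ t nothing σ′ →
                    iteration ∶ σ′ ⟶[ t′ ] r , σ″ → Steps iteration s σ (t + t′) r σ″
  iteration-again {s} {σ} (exit {t = t} eq) p′ =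
    more (exec-map _ (Machine.instr M s) σ eq) (slower (m≤n+m _ t) p′)
  iteration-again {s} {σ} (more eq p) p′ =
    more (exec-map _ (Machine.instr M s) σ eq) (iteration-again p p′)

infixl 1 _>>=_ _>>_ _⨾_

-- Sealed, so that programs are reasoned about through their run rules alone and their state spaces
-- never unfold.
opaque

  ret : ∀ {k R} → R → Machine k R
  ret r = primitive₁ (nop r)

  popM : ∀ {k} → Fin (suc k) → Machine k (Maybe Symbol)
  popM i = primitive₁ (pop i id)

  pushM : ∀ {k} → Fin (suc k) → Symbol → Machine k Unit
  pushM i c = primitive₁ (push i c tt)

  _>>=_ : ∀ {k R R′} ⦃ fin : Finite R ⦄ → Machine k R → (R → Machine k R′) → Machine k R′
  _>>=_ ⦃ fin ⦄ = bind ⦃ fin ⦄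

  loop : ∀ {k R} → Machine k (Maybe R) → Machine k R
  loop = iteration

  run-ret : ∀ {k R} {r : R} {σ} → ret {k} r ∶ σ ⟶[ 1 ] r , σ
  run-ret = run-primitive₁ (nop _) refl

  run-popM : ∀ {k i σ} → popM {k} i ∶ σ ⟶[ 1 ] List.head (lookup σ i) , σ [ i ]≔ drop 1 (lookup σ i)
  run-popM {i = i} = run-primitive₁ (pop i id) refl

  run-push : ∀ {k i c σ} → pushM {k} i c ∶ σ ⟶[ 1 ] tt , σ [ i ]≔ (c ∷ lookup σ i)
  run-push {i = i} {c} = run-primitive₁ (push i c tt) refl

  _⨾_ : ∀ {k R R′} ⦃ fin : Finite R ⦄ {M : Machine k R} {N : R → Machine k R′} {σ t r σ′ t′ r′ σ″} →
        M ∶ σ ⟶[ t ] r , σ′ → N r ∶ σ′ ⟶[ t′ ] r′ , σ″ → _>>=_ ⦃ fin ⦄ M N ∶ σ ⟶[ t + t′ ] r′ , σ″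
  _⨾_ ⦃ fin ⦄ {M = M} {N} = run-first ⦃ fin ⦄ M N

  run-last : ∀ {k R} {M : Machine k (Maybe R)} {σ t r σ′} →
             M ∶ σ ⟶[ t ] just r , σ′ → loop M ∶ σ ⟶[ t ] r , σ′
  run-last {M = M} = iteration-last M

  run-again : ∀ {k R} {M : Machine k (Maybe R)} {σ t σ′ t′ r σ″} →
              M ∶ σ ⟶[ t ] nothing , σ′ → loop M ∶ σ′ ⟶[ t′ ] r , σ″ → loop M ∶ σ ⟶[ t + t′ ] r , σ″
  run-again {M = M} = iteration-again M

_>>_ : ∀ {k R R′} ⦃ fin : Finite R ⦄ → Machine k R → Machine k R′ → Machine k R′
M >> N = M >>= λ _ → N

-- Translation of stack machines to Turing machines

module _ {k : ℕ} (M : Machine k Bool) where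
  open Machine M using (State; instr; finite)

  private
    Γ : Set
    Γ = Maybe Symbol

  idle : Vec Γ (suc k) → Vec (Γ × Move) (suc k)
  idle = Vec.map (_, stay)

  -- A stack is kept on a tape with its top under the head.  As the head has
  -- to move before a symbol can be pushed, pushing takes two steps, and the
  -- second component of a state tells whether the move has been made.

  transition : (State ⊎ Bool) × Bool → Vec Γ (suc k) →
               ((State ⊎ Bool) × Bool) × Vec (Γ × Move) (suc k)
  transition (inj₂ b , moved) γs = (inj₂ b , moved) , idle γs
  transition (inj₁ s , moved) γs with instr s
  ... | pop i κ    = (κ (lookup γs i) , false) , idle γs [ i ]≔ (nothing , right)
  ... | push i c q = ((if moved then q else inj₁ s) , (if moved then false else true)) ,
                     idle γs [ i ]≔ (if moved then (just c , stay) else (lookup γs i , left))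
  ... | nop q      = (q , false) , idle γs

  toTM : TM Symbol
  toTM = record
    { k         = k
    ; State     = (State ⊎ Bool) × Bool
    ; Γ         = Maybe Symbol
    ; State-fin = finite-× (finite-⊎ finite finite-Bool) finite-Bool
    ; Γ-fin     = finite-MaybeSymbol
    ; embed     = mk↣ {to = id} id
    ; start     = inj₁ (start M) , false
    ; verdict   = λ (q , _) → Sum.[ (λ _ → nothing) , just ] q
    ; δ         = transition
    }

  open Run toTM

  -- Cells to the left of the head are left free, because a push overwrites the cell it moves to.
  -- The number `j` of blanks varies, because popping an empty stack moves the head further into the
  -- blanks.
  Represents : List Symbol → Tape → Set
  Represents s (tape _ h rs) = ∃ λ j → h ∷ rs ≡ map just s ++ replicate j nothing

  represents-head : ∀ s t → Represents s t → Tape.head t ≡ List.head s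
  represents-head []      t (suc j , refl) = refl
  represents-head (c ∷ s) t (j     , refl) = refl

  represents-pop : ∀ s t → Represents s t → Represents (drop 1 s) (act (nothing , right) t)
  represents-pop []          (tape ls _ [])       (suc j , eq) = 1 , refl
  represents-pop []          (tape ls _ (_ ∷ rs)) (suc j , eq) = j , ∷-injectiveʳ eq
  represents-pop (c ∷ [])    (tape ls _ [])       (j , eq)     = 1 , refl
  represents-pop (c ∷ _ ∷ s) (tape ls _ [])       (j , ())
  represents-pop (c ∷ s)     (tape ls _ (_ ∷ rs)) (j , eq)     = j , ∷-injectiveʳ eq

  represents-push : ∀ c s t → Represents s t →
    Represents (c ∷ s) (act (just c , stay) (act (Tape.head t , left) t))
  represents-push c s (tape []       h rs) (j , eq) = j , cong (just c ∷_) eq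
  represents-push c s (tape (_ ∷ ls) h rs) (j , eq) = j , cong (just c ∷_) eq

  private
    Tapes : Set
    Tapes = Vec Tape (suc k)

  RepresentsAll : Stacks → Tapes → Set
  RepresentsAll σ ts = ∀ i → Represents (lookup σ i) (lookup ts i)

  heads : Tapes → Vec Γ (suc k)
  heads = Vec.map Tape.head

  actAt : Fin (suc k) → Γ × Move → Tapes → Tapes
  actAt i a ts = Vec.zipWith act (idle (heads ts) [ i ]≔ a) ts

  lookup-actAt : ∀ i a ts → lookup (actAt i a ts) i ≡ act a (lookup ts i)
  lookup-actAt i a ts = trans (lookup-zipWith act i (idle (heads ts) [ i ]≔ a) ts)
    (cong (λ b → act b (lookup ts i)) (lookup∘update i (idle (heads ts)) a))

  act-idle : ∀ j ts → act (lookup (idle (heads ts)) j) (lookup ts j) ≡ lookup ts j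
  act-idle j ts = subst (λ a → act a (lookup ts j) ≡ lookup ts j) (sym lookup-idle) refl
    where
    lookup-idle : lookup (idle (heads ts)) j ≡ (Tape.head (lookup ts j) , stay)
    lookup-idle = trans (lookup-map j (_, stay) (heads ts)) (cong (_, stay) (lookup-map j Tape.head ts))

  lookup-actAt′ : ∀ {i j} → j ≢ i → ∀ a ts → lookup (actAt i a ts) j ≡ lookup ts j
  lookup-actAt′ {i} {j} j≢i a ts = trans (lookup-zipWith act j (idle (heads ts) [ i ]≔ a) ts)
    (trans (cong (λ b → act b (lookup ts j)) (lookup∘update′ j≢i (idle (heads ts)) a))
           (act-idle j ts))

  represents-update : ∀ i s σ ts ts′ → RepresentsAll σ ts →
    Represents s (lookup ts′ i) → (∀ {j} → j ≢ i → lookup ts′ j ≡ lookup ts j) →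
    RepresentsAll (σ [ i ]≔ s) ts′
  represents-update i s σ ts ts′ rep at others j with j ≟ i
  ... | yea refl = subst (λ s′ → Represents s′ (lookup ts′ i)) (sym (lookup∘update i σ s)) at
  ... | nay j≢i  =
    subst₂ Represents (sym (lookup∘update′ j≢i σ s)) (sym (others j≢i)) (rep j)

  represents-idle : ∀ σ ts → RepresentsAll σ ts →
                    RepresentsAll σ (Vec.zipWith act (idle (heads ts)) ts)
  represents-idle σ ts rep j = subst (Represents (lookup σ j))
    (sym (trans (lookup-zipWith act j (idle (heads ts)) ts) (act-idle j ts))) (rep j)

  represents-popAt : ∀ i σ ts → RepresentsAll σ ts →
    RepresentsAll (σ [ i ]≔ drop 1 (lookup σ i)) (actAt i (nothing , right) ts)
  represents-popAt i σ ts rep =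
    represents-update i _ σ ts (actAt i (nothing , right) ts) rep
    (subst (Represents (drop 1 (lookup σ i))) (sym (lookup-actAt i (nothing , right) ts))
      (represents-pop (lookup σ i) (lookup ts i) (rep i)))
    (λ j≢i → lookup-actAt′ j≢i (nothing , right) ts)

  represents-pushAt : ∀ i c σ ts → RepresentsAll σ ts →
    RepresentsAll (σ [ i ]≔ (c ∷ lookup σ i))
                  (actAt i (just c , stay) (actAt i (lookup (heads ts) i , left) ts))
  represents-pushAt i c σ ts rep =
    represents-update i _ σ ts (actAt i (just c , stay) ts₁) rep
    (subst (Represents (c ∷ lookup σ i)) (sym at)
      (represents-push c (lookup σ i) (lookup ts i) (rep i)))
    (λ j≢i → trans (lookup-actAt′ j≢i (just c , stay) ts₁) (lookup-actAt′ j≢i _ ts))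
    where
    ts₁ = actAt i (lookup (heads ts) i , left) ts
    at₁ : lookup ts₁ i ≡ act (Tape.head (lookup ts i) , left) (lookup ts i)
    at₁ = trans (lookup-actAt i (lookup (heads ts) i , left) ts)
      (cong (λ h → act (h , left) (lookup ts i)) (lookup-map i Tape.head ts))
    at : lookup (actAt i (just c , stay) ts₁) i
         ≡ act (just c , stay) (act (Tape.head (lookup ts i) , left) (lookup ts i))
    at = trans (lookup-actAt i (just c , stay) ts₁) (cong (act (just c , stay)) at₁)

  heads-represent : ∀ i σ ts → RepresentsAll σ ts →
                    lookup (heads ts) i ≡ List.head (lookup σ i)
  heads-represent i σ ts rep =
    trans (lookup-map i Tape.head ts) (represents-head (lookup σ i) (lookup ts i) (rep i))

  Answers : (State ⊎ Bool) × Bool → Tapes → ℕ → Bool → Set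
  Answers q ts t b = TM.verdict toTM (proj₁ (iterate next (q , ts) t)) ≡ just b

  halted : ∀ t {b m ts} → Answers (inj₂ b , m) ts t b
  halted zero    = refl
  halted (suc t) = halted t

  -- Each instruction is allotted the two steps of a push. As `pop` and `nop` finish after one, the
  -- rest of the run is required to answer at every time from `t` on, not just at `t`.
  answers-step : ∀ s σ {q σ′} ts → exec (instr s) σ ≡ (q , σ′) → RepresentsAll σ ts →
    ∀ {b} t → (∀ ts′ t′ → t ≤ t′ → RepresentsAll σ′ ts′ → Answers (q , false) ts′ t′ b) →
    ∀ t′ → 2 + t ≤ t′ → Answers (inj₁ s , false) ts t′ b
  answers-step s σ ts eq rep t rest (suc (suc t′)) (s≤s (s≤s t≤t′)) with instr s in at | eq
  ... | pop i κ | refl =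
    subst (λ γ → Answers (κ γ , false) (actAt i (nothing , right) ts) (suc t′) _)
      (sym (heads-represent i σ ts rep))
      (rest _ (suc t′) (m≤n⇒m≤1+n t≤t′) (represents-popAt i σ ts rep))
  ... | nop q      | refl = rest _ (suc t′) (m≤n⇒m≤1+n t≤t′) (represents-idle σ ts rep)
  ... | push i c q | refl rewrite at = rest _ t′ t≤t′ (represents-pushAt i c σ ts rep)

  answers : ∀ {s σ t b σ′} ts → Steps M s σ t b σ′ → RepresentsAll σ ts →
            ∀ t′ → 2 * t ≤ t′ → Answers (inj₁ s , false) ts t′ b
  answers {s} {σ} ts (exit {t = t} eq) rep t′ le =
    answers-step s σ ts eq rep (2 * t) (λ _ t″ _ _ → halted t″) t′
      (subst (_≤ t′) (*-suc 2 t) le)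
  answers {s} {σ} ts (more {t = t} eq p) rep t′ le =
    answers-step s σ ts eq rep (2 * t) (λ ts′ t″ le′ rep′ → answers ts′ p rep′ t″ le′) t′
      (subst (_≤ t′) (*-suc 2 t) le)

  initially : ∀ w → RepresentsAll (w Vec.∷ Vec.replicate k []) (proj₂ (initial w))
  initially []      0F = 1 , refl
  initially (c ∷ w) 0F = 0 , sym (++-identityʳ _)
  initially w (Fin.suc i) = subst₂ Represents
    (sym (lookup-replicate i [])) (sym (lookup-replicate i emptyTape)) (1 , refl)

  answers-initial : ∀ {w t b σ′} → M ∶ w Vec.∷ Vec.replicate k [] ⟶[ t ] b , σ′ →
                    ∀ t′ → 2 * t ≤ t′ → answer w t′ ≡ just b
  answers-initial {w} run = answers (proj₂ (initial w)) run (initially w)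

-- Stack programs on names

-- The digits of a bijective binary numeral, treated as a string: equality is all that is ever
-- tested of a name.
Name : Set
Name = List Bool

digit : Bool → Symbol
digit false = one
digit true  = two

tok : Name → List Symbol → List Symbol
tok []       p = end ∷ p
tok (d ∷ ds) p = digit d ∷ tok ds p

tok-++ : ∀ w p → tok w [] ++ p ≡ tok w p
tok-++ []      p = refl
tok-++ (d ∷ w) p = cong (digit d ∷_) (tok-++ w p)

toks : List Name → List Symbol
toks []       = []
toks (w ∷ ws) = tok w (toks ws)

same : Name → Name → Bool
same []          []          = true
same []          (_ ∷ _)     = false
same (_ ∷ _)     []          = false
same (false ∷ v) (false ∷ w) = same v w
same (false ∷ v) (true  ∷ w) = false
same (true  ∷ v) (false ∷ w) = false
same (true  ∷ v) (true  ∷ w) = same v w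

same⇒≡ : ∀ v w → same v w ≡ true → v ≡ w
same⇒≡ []          []          _  = refl
same⇒≡ (false ∷ v) (false ∷ w) eq = cong (false ∷_) (same⇒≡ v w eq)
same⇒≡ (true  ∷ v) (true  ∷ w) eq = cong (true ∷_) (same⇒≡ v w eq)

same-refl : ∀ v → same v v ≡ true
same-refl []          = refl
same-refl (false ∷ v) = same-refl v
same-refl (true  ∷ v) = same-refl v

rename : Name → Name → Name → Name
rename a b v = if same v b then a else v

≤-by : ∀ {a b} s → a + s ≡ b → a ≤ b
≤-by {a} s refl = m≤m+n a s

ʳ++⁺ : ∀ {A : Set} {P : A → Set} {xs ys} → All P xs → All P ys → All P (xs ʳ++ ys)
ʳ++⁺ []         pys = pys
ʳ++⁺ (px ∷ pxs) pys = ʳ++⁺ pxs (px ∷ pys)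

private
  M : Set → Set₁
  M = Machine 9

-- Stack 0 holds the input, stacks 1 to 3 hold pairs of names, 4 and 5 the
-- names compared to or replaced, and the others are auxiliary.

pattern inp   = 0F
pattern zeros = 1F
pattern ones  = 2F
pattern undec = 3F
pattern fst   = 4F
pattern snd   = 5F
pattern aux   = 6F
pattern tmp   = 7F
pattern cmp₁  = 8F
pattern cmp₂  = 9F

transferStep : (Symbol → M Unit) → Maybe Symbol → M (Maybe Unit)
transferStep out nothing    = ret (just tt)
transferStep out (just end) = ret (just tt)
transferStep out (just c)   = out c >> ret nothing

-- The end mark is put out first, as it has to lie below the digits. These come out in reverse
-- order, which is why `mv` and `cp` go through `tmp`.
transfer : Fin 10 → (Symbol → M Unit) → M Unit
transfer i out = out end >> loop (popM i >>= transferStep out)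

pushBoth : Fin 10 → Fin 10 → Symbol → M Unit
pushBoth i j c = pushM i c >> pushM j c

mv cp : Fin 10 → Fin 10 → M Unit
mv i j = transfer i (pushM tmp) >> transfer tmp (pushM j)
cp i j = transfer i (pushM tmp) >> transfer tmp (pushBoth i j)

discard : Fin 10 → M Unit
discard i = transfer i (λ _ → ret tt)

-- At the first difference the unread rests of both names are removed, so that a comparison consumes
-- exactly the two names, whatever its outcome.
compareSymbols : Maybe Symbol → Maybe Symbol → M (Maybe Bool)
compareSymbols (just one) (just one) = ret nothing
compareSymbols (just two) (just two) = ret nothing
compareSymbols (just end) (just end) = ret (just true)
compareSymbols (just end) _          = discard cmp₂ >> ret (just false)
compareSymbols _          (just end) = discard cmp₁ >> ret (just false)
compareSymbols _          _          = discard cmp₁ >> discard cmp₂ >> ret (just false)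

compareStep : M (Maybe Bool)
compareStep = popM cmp₁ >>= λ c → popM cmp₂ >>= compareSymbols c

compareTops : M Bool
compareTops = loop compareStep

test : Fin 10 → Fin 10 → M Bool
test i j = cp i cmp₁ >> cp j cmp₂ >> compareTops

putBack : Fin 10 → Maybe Symbol → M Bool
putBack i nothing  = ret false
putBack i (just c) = pushM i c >> ret true

peek : Fin 10 → M Bool
peek i = popM i >>= putBack i

passStep : M Unit → Bool → M (Maybe Unit)
passStep visit true  = visit >> ret nothing
passStep visit false = ret (just tt)

pass : Fin 10 → M Unit → M Unit
pass i visit = loop (peek i >>= passStep visit)

-- `fst` holds the new name and `snd` the one that it replaces.
replaceTop : Fin 10 → Bool → M Unit
replaceTop i true  = discard i >> cp fst aux
replaceTop i false = mv i aux

renameTop : Fin 10 → M Unit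
renameTop i = test i snd >>= replaceTop i

-- The first pass reverses the pile on its way to `aux`; the second restores the order.
renameAll : Fin 10 → M Unit
renameAll i = pass i (renameTop i) >> pass aux (mv aux i)

-- Effect and running time of the programs

set-same : ∀ {i p} (σ : Stacks {9}) → lookup σ i ≡ p → σ [ i ]≔ p ≡ σ
set-same {i} σ refl = []≔-lookup σ i

module _ {i j : Fin 10} (i≢j : i ≢ j) (σ : Stacks {9}) where

  at₁ : ∀ p q → lookup (σ [ i ]≔ p [ j ]≔ q) i ≡ p
  at₁ p q = trans (lookup∘update′ i≢j (σ [ i ]≔ p) q) (lookup∘update i σ p)

  set₁ : ∀ p q p′ → σ [ i ]≔ p [ j ]≔ q [ i ]≔ p′ ≡ σ [ i ]≔ p′ [ j ]≔ q
  set₁ p q p′ = trans (cong (_[ i ]≔ p′) ([]≔-commutes σ i j i≢j))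
    (trans ([]≔-idempotent (σ [ j ]≔ q) i) ([]≔-commutes σ j i (≢-sym i≢j)))

  at₂ : ∀ p q → lookup (σ [ i ]≔ p [ j ]≔ q) j ≡ q
  at₂ p q = lookup∘update j (σ [ i ]≔ p) q

  set₂ : ∀ p q q′ → σ [ i ]≔ p [ j ]≔ q [ j ]≔ q′ ≡ σ [ i ]≔ p [ j ]≔ q′
  set₂ p q q′ = []≔-idempotent (σ [ i ]≔ p) j

infixr 0 from_,_ to_,_

from_,_ : ∀ {k R} {M : Machine k R} {σ σ₀ t r σ′} →
          σ ≡ σ₀ → M ∶ σ ⟶[ t ] r , σ′ → M ∶ σ₀ ⟶[ t ] r , σ′
from refl , run = run

to_,_ : ∀ {k R} {M : Machine k R} {σ t r σ′ σ″} →
        σ′ ≡ σ″ → M ∶ σ ⟶[ t ] r , σ′ → M ∶ σ ⟶[ t ] r , σ″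
to refl , run = run

run-pop : ∀ {i} {σ : Stacks {9}} {c p} → lookup σ i ≡ c ∷ p → popM i ∶ σ ⟶[ 1 ] just c , σ [ i ]≔ p
run-pop {i} {σ} eq = subst (λ s → popM i ∶ σ ⟶[ 1 ] List.head s , σ [ i ]≔ drop 1 s) eq run-popM

module _ (i : Fin 10) (out : Symbol → M Unit) (F : List Symbol → List Symbol → Stacks {9})
         (at : ∀ p q → lookup (F p q) i ≡ p) (set : ∀ p q p′ → F p q [ i ]≔ p′ ≡ F p′ q)
         (put : ∀ c p q → out c ∶ F p q ⟶[ 2 ] tt , F p (c ∷ q)) where

  private
    next-symbol : ∀ c p q → popM i ∶ F (c ∷ p) q ⟶[ 1 ] just c , F p q
    next-symbol c p q = to set _ _ _ , run-pop (at _ _)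

    transfer-digit : ∀ d p q → transferStep out (just (digit d)) ∶ F p q ⟶[ 3 ] nothing , F p (digit d ∷ q)
    transfer-digit false p q = put _ p q ⨾ run-ret
    transfer-digit true  p q = put _ p q ⨾ run-ret

    run-loop : ∀ w acc p q → loop (popM i >>= transferStep out) ∶ F (tok w p) (tok acc q)
               ⟶[ 4 * length w + 2 ] tt , F p (tok (w ʳ++ acc) q)
    run-loop []      acc p q = run-last (next-symbol end p _ ⨾ run-ret)
    run-loop (d ∷ w) acc p q = slower (≤-reflexive (cong (_+ 2) (sym (*-suc 4 (length w)))))
      (run-again (next-symbol (digit d) _ _ ⨾ transfer-digit d _ _) (run-loop w (d ∷ acc) p q))

  -- With `out` and `F` abstract, filling a stack, discarding a name and copying onto two stacks are
  -- all instances. A digit costs 4: one step to pop it, two to put it out, one to return.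
  run-transfer : ∀ w p q → transfer i out ∶ F (tok w p) q
                 ⟶[ 4 * suc (length w) ] tt , F p (tok (reverse w) q)
  run-transfer w p q = slower (≤-reflexive (trans (cong (2 +_) (+-comm _ 2)) (sym (*-suc 4 (length w)))))
    (put end _ q ⨾ run-loop w [] p q)

run-fill : ∀ {i j} → i ≢ j → ∀ {σ w p} → lookup σ i ≡ tok w p →
           transfer i (pushM j) ∶ σ ⟶[ 4 * suc (length w) ] tt ,
             σ [ i ]≔ p [ j ]≔ tok (reverse w) (lookup σ j)
run-fill {i} {j} i≢j {σ} {w} {p} eq =
  from unchanged ,
    (run-transfer i (pushM j) (λ p q → σ [ i ]≔ p [ j ]≔ q)
      (at₁ i≢j σ) (set₁ i≢j σ) put w p (lookup σ j))
  where
  unchanged : σ [ i ]≔ tok w p [ j ]≔ lookup σ j ≡ σ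
  unchanged = trans (cong (_[ j ]≔ lookup σ j) (set-same σ eq)) ([]≔-lookup σ j)
  put : ∀ c p q → pushM j c ∶ σ [ i ]≔ p [ j ]≔ q ⟶[ 2 ] tt , σ [ i ]≔ p [ j ]≔ (c ∷ q)
  put c p q = slower (s≤s z≤n) (to
    (trans (set₂ i≢j σ p q _) (cong (λ s → σ [ i ]≔ p [ j ]≔ (c ∷ s)) (at₂ i≢j σ p q))) , run-push)

run-discard : ∀ {i σ} w {p} → lookup σ i ≡ tok w p →
              discard i ∶ σ ⟶[ 4 * suc (length w) ] tt , σ [ i ]≔ p
run-discard {i} {σ} w {p} eq =
  from set-same σ eq ,
    (run-transfer i (λ _ → ret tt) (λ p _ → σ [ i ]≔ p)
      (λ p _ → lookup∘update i σ p) (λ p _ p′ → []≔-idempotent σ i)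
      (λ _ _ _ → slower (s≤s z≤n) run-ret) w p [])

double : ∀ n → 4 * n + 4 * n ≡ 8 * n
double n = sym (*-distribʳ-+ n 4 4)

module _ {i j : Fin 10} (i≢j : i ≢ j) (i≢tmp : i ≢ tmp) (j≢tmp : j ≢ tmp)
         {σ : Stacks {9}} w {p} (eq : lookup σ i ≡ tok w p) where

  private
    τ : List Symbol
    τ = lookup σ tmp

    σ₁ : Stacks {9}
    σ₁ = σ [ i ]≔ p [ tmp ]≔ tok (reverse w) τ

    first : transfer i (pushM tmp) ∶ σ ⟶[ 4 * suc (length w) ] tt , σ₁
    first = run-fill i≢tmp eq

    restored : σ₁ [ tmp ]≔ τ ≡ σ [ i ]≔ p
    restored = trans ([]≔-idempotent (σ [ i ]≔ p) tmp)
      (set-same (σ [ i ]≔ p) (lookup∘update′ (≢-sym i≢tmp) σ p))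

    lookup-j : lookup σ₁ j ≡ lookup σ j
    lookup-j = trans (lookup∘update′ j≢tmp (σ [ i ]≔ p) _) (lookup∘update′ (≢-sym i≢j) σ p)

  run-mv : mv i j ∶ σ ⟶[ 8 * suc (length w) ] tt , σ [ i ]≔ p [ j ]≔ tok w (lookup σ j)
  run-mv = slower (≤-reflexive (trans (cong (λ l → 4 * suc (length w) + 4 * suc l) (length-reverse w))
                                      (double (suc (length w)))))
    (to final ,
      (first ⨾ run-fill (≢-sym j≢tmp) (lookup∘update tmp (σ [ i ]≔ p) _)))
    where
    final : σ₁ [ tmp ]≔ τ [ j ]≔ tok (reverse (reverse w)) (lookup σ₁ j)
            ≡ σ [ i ]≔ p [ j ]≔ tok w (lookup σ j)
    final = cong₂ (λ σ′ s → σ′ [ j ]≔ s) restored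
      (cong₂ tok (reverse-involutive w) lookup-j)

  run-cp : cp i j ∶ σ ⟶[ 8 * suc (length w) ] tt , σ [ j ]≔ tok w (lookup σ j)
  run-cp = slower (≤-reflexive (trans (cong (λ l → 4 * suc (length w) + 4 * suc l) (length-reverse w))
                                      (double (suc (length w)))))
    (first ⨾ (from begins , to final ,
      run-transfer tmp (pushBoth i j) F at set put (reverse w) τ []))
    where
    -- `q` is only the part written so far. It lies on both stacks, above what each held before, so
    -- that copying onto two stacks becomes a transfer with a single output.
    F : List Symbol → List Symbol → Stacks {9}
    F t q = σ [ tmp ]≔ t [ i ]≔ (q ++ p) [ j ]≔ (q ++ lookup σ j)
    at : ∀ t q → lookup (F t q) tmp ≡ t
    at t q = trans (lookup∘update′ (≢-sym j≢tmp) (σ [ tmp ]≔ t [ i ]≔ (q ++ p)) _)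
      (at₁ (≢-sym i≢tmp) σ t (q ++ p))
    set : ∀ t q t′ → F t q [ tmp ]≔ t′ ≡ F t′ q
    set t q t′ = trans ([]≔-commutes (σ [ tmp ]≔ t [ i ]≔ (q ++ p)) j tmp j≢tmp)
      (cong (_[ j ]≔ (q ++ lookup σ j)) (set₁ (≢-sym i≢tmp) σ t (q ++ p) t′))
    put : ∀ c t q → pushBoth i j c ∶ F t q ⟶[ 2 ] tt , F t (c ∷ q)
    put c t q = run-push ⨾ (to pushed , run-push)
      where
      σ₂ = σ [ tmp ]≔ t
      lookup-i : lookup (F t q) i ≡ q ++ p
      lookup-i = at₁ i≢j σ₂ (q ++ p) (q ++ lookup σ j)
      moved : F t q [ i ]≔ (c ∷ lookup (F t q) i) ≡ σ₂ [ i ]≔ (c ∷ q ++ p) [ j ]≔ (q ++ lookup σ j)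
      moved = trans (cong (λ s → F t q [ i ]≔ (c ∷ s)) lookup-i)
        (set₁ i≢j σ₂ (q ++ p) (q ++ lookup σ j) (c ∷ q ++ p))
      pushed : F t q [ i ]≔ (c ∷ lookup (F t q) i) [ j ]≔ (c ∷ lookup (F t q [ i ]≔ (c ∷ lookup (F t q) i)) j)
               ≡ F t (c ∷ q)
      pushed = trans (cong (λ σ′ → σ′ [ j ]≔ (c ∷ lookup σ′ j)) moved)
        (trans (cong (λ s → σ₂ [ i ]≔ (c ∷ q ++ p) [ j ]≔ (q ++ lookup σ j) [ j ]≔ (c ∷ s))
                 (at₂ i≢j σ₂ (c ∷ q ++ p) (q ++ lookup σ j)))
               (set₂ i≢j σ₂ (c ∷ q ++ p) (q ++ lookup σ j) (c ∷ q ++ lookup σ j)))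
    begins : F (tok (reverse w) τ) [] ≡ σ₁
    begins = trans (set-same (σ [ tmp ]≔ _ [ i ]≔ p)
        (trans (lookup∘update′ (≢-sym i≢j) (σ [ tmp ]≔ _) p) (lookup∘update′ j≢tmp σ _)))
      ([]≔-commutes σ tmp i (≢-sym i≢tmp))
    final : F τ (tok (reverse (reverse w)) []) ≡ σ [ j ]≔ tok w (lookup σ j)
    final = cong₂ (λ σ′ s → σ′ [ j ]≔ s)
      (trans (cong₂ (λ σ′ s → σ′ [ i ]≔ s) ([]≔-lookup σ tmp)
                (trans (tok-++ (reverse (reverse w)) p) (cong (λ v → tok v p) (reverse-involutive w))))
             (set-same σ eq))
      (trans (tok-++ (reverse (reverse w)) _) (cong (λ v → tok v _) (reverse-involutive w)))

module _ (σ : Stacks {9}) where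

  private
    F : List Symbol → List Symbol → Stacks {9}
    F p q = σ [ cmp₁ ]≔ p [ cmp₂ ]≔ q

    pops : ∀ {c c′ p q t b σ′} → compareSymbols (just c) (just c′) ∶ F p q ⟶[ t ] b , σ′ →
           compareStep ∶ F (c ∷ p) (c′ ∷ q) ⟶[ 2 + t ] b , σ′
    pops {p = p} {q} run =
      (to set₁ (λ ()) σ _ _ p , run-pop (at₁ (λ ()) σ _ _)) ⨾
      ((to set₂ {i = cmp₁} (λ ()) σ _ _ q , run-pop (at₂ {i = cmp₁} (λ ()) σ _ _)) ⨾ run)

    discard₁ : ∀ w {p q} → discard cmp₁ ∶ F (tok w p) q ⟶[ 4 * suc (length w) ] tt , F p q
    discard₁ w = to set₁ (λ ()) σ _ _ _ , run-discard w (at₁ (λ ()) σ _ _)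

    discard₂ : ∀ w {p q} → discard cmp₂ ∶ F p (tok w q) ⟶[ 4 * suc (length w) ] tt , F p q
    discard₂ w = to set₂ {i = cmp₁} (λ ()) σ _ _ _ , run-discard w (at₂ {i = cmp₁} (λ ()) σ _ _)

    cost-one : ∀ n → 2 + (4 * suc n + 1) + 5 ≡ 4 * (1 + suc (suc n))
    cost-one = solve-∀

    cost-one′ : ∀ n → 2 + (4 * suc n + 1) + 5 ≡ 4 * (suc (suc n) + 1)
    cost-one′ = solve-∀

    cost-two : ∀ m n → 2 + (4 * suc m + 4 * suc n + 1) + 5 ≡ 4 * (suc (suc m) + suc (suc n))
    cost-two = solve-∀

    cost-again : ∀ m n → 2 + 1 + 4 * (suc m + suc n) + 5 ≡ 4 * (suc (suc m) + suc (suc n))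
    cost-again = solve-∀

  -- The factor 4 is the cost per symbol of discarding the rests after a difference; a round on two
  -- equal digits costs only 3. Every case leaves 5 steps to spare.
  run-compareTops : ∀ v w p q → compareTops ∶ F (tok v p) (tok w q)
                    ⟶[ 4 * (suc (length v) + suc (length w)) ] same v w , F p q
  run-compareTops []          []          p q = slower (≤-by 5 refl) (run-last (pops run-ret))
  run-compareTops []          (false ∷ w) p q =
    slower (≤-by 5 (cost-one (length w))) (run-last (pops (discard₂ w ⨾ run-ret)))
  run-compareTops []          (true ∷ w)  p q =
    slower (≤-by 5 (cost-one (length w))) (run-last (pops (discard₂ w ⨾ run-ret)))
  run-compareTops (false ∷ v) []          p q =
    slower (≤-by 5 (cost-one′ (length v))) (run-last (pops (discard₁ v ⨾ run-ret)))
  run-compareTops (true ∷ v)  []          p q =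
    slower (≤-by 5 (cost-one′ (length v))) (run-last (pops (discard₁ v ⨾ run-ret)))
  run-compareTops (false ∷ v) (true ∷ w)  p q =
    slower (≤-by 5 (cost-two (length v) (length w)))
      (run-last (pops (discard₁ v ⨾ discard₂ w ⨾ run-ret)))
  run-compareTops (true ∷ v)  (false ∷ w) p q =
    slower (≤-by 5 (cost-two (length v) (length w)))
      (run-last (pops (discard₁ v ⨾ discard₂ w ⨾ run-ret)))
  run-compareTops (false ∷ v) (false ∷ w) p q =
    slower (≤-by 5 (cost-again (length v) (length w)))
      (run-again (pops run-ret) (run-compareTops v w p q))
  run-compareTops (true ∷ v)  (true ∷ w)  p q =
    slower (≤-by 5 (cost-again (length v) (length w)))
      (run-again (pops run-ret) (run-compareTops v w p q))

run-peek : ∀ {i σ} w {p} → lookup σ i ≡ tok w p → peek i ∶ σ ⟶[ 3 ] true , σ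
run-peek {i} {σ} w eq = nonempty w eq
  where
  restored : ∀ {c p} → lookup σ i ≡ c ∷ p → σ [ i ]≔ p [ i ]≔ (c ∷ lookup (σ [ i ]≔ p) i) ≡ σ
  restored {c} {p} eq = trans ([]≔-idempotent σ i)
    (trans (cong (λ s → σ [ i ]≔ (c ∷ s)) (lookup∘update i σ p)) (set-same σ eq))
  nonempty : ∀ w {p} → lookup σ i ≡ tok w p → peek i ∶ σ ⟶[ 3 ] true , σ
  nonempty []      eq = run-pop eq ⨾ ((to restored eq , run-push) ⨾ run-ret)
  nonempty (d ∷ w) eq = run-pop eq ⨾ ((to restored eq , run-push) ⨾ run-ret)

run-peek-[] : ∀ {i σ} → lookup σ i ≡ [] → peek i ∶ σ ⟶[ 3 ] false , σ
run-peek-[] {i} {σ} eq = slower (s≤s (s≤s z≤n)) (popped ⨾ run-ret)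
  where
  popped : popM i ∶ σ ⟶[ 1 ] nothing , σ
  popped = to set-same σ eq ,
    subst (λ s → popM i ∶ σ ⟶[ 1 ] List.head s , σ [ i ]≔ drop 1 s) eq run-popM

-- Running times for names of bounded length

module Bounded (B : ℕ) where

  Short : Name → Set
  Short w = length w ≤ B

  -- The length of a longest name together with its end mark, the unit of all times below.
  β : ℕ
  β = suc B

  private
    scale : ∀ c {n} → n ≤ B → c * suc n ≤ c * β
    scale c n≤B = *-monoʳ-≤ c (s≤s n≤B)

  module _ {i j : Fin 10} (i≢j : i ≢ j) (i≢tmp : i ≢ tmp) (j≢tmp : j ≢ tmp)
           {σ : Stacks {9}} {w p} (short : Short w) (eq : lookup σ i ≡ tok w p) where

    mv-short : mv i j ∶ σ ⟶[ 8 * β ] tt , σ [ i ]≔ p [ j ]≔ tok w (lookup σ j)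
    mv-short = slower (scale 8 short) (run-mv i≢j i≢tmp j≢tmp w eq)

    cp-short : cp i j ∶ σ ⟶[ 8 * β ] tt , σ [ j ]≔ tok w (lookup σ j)
    cp-short = slower (scale 8 short) (run-cp i≢j i≢tmp j≢tmp w eq)

  discard-short : ∀ {i σ w p} → Short w → lookup σ i ≡ tok w p →
                  discard i ∶ σ ⟶[ 4 * β ] tt , σ [ i ]≔ p
  discard-short {w = w} short eq = slower (scale 4 short) (run-discard w eq)

  -- Two copies and one comparison cost 8 `β` each. The hypotheses keep `i` and `j` off stacks 7 to
  -- 9, which are `tmp`, `cmp₁` and `cmp₂`.
  run-test : ∀ {i j σ v w p q} → (∀ l → i ≢ 7 ↑ʳ l) → (∀ l → j ≢ 7 ↑ʳ l) →
             Short v → Short w → lookup σ i ≡ tok v p → lookup σ j ≡ tok w q →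
             test i j ∶ σ ⟶[ 24 * β ] same v w , σ
  run-test {i} {j} {σ} {v} {w} {p} {q} i≢ j≢ short-v short-w eq-v eq-w =
    slower (≤-trans (+-monoʳ-≤ (8 * β + 8 * β) compare-cost) (≤-reflexive (cost β)))
      (cp-short (i≢ 1F) (i≢ 0F) (λ ()) short-v eq-v ⨾
       cp-short (j≢ 2F) (j≢ 0F) (λ ()) short-w (trans (lookup∘update′ (j≢ 1F) σ _) eq-w) ⨾
       (from sym copied , to restored , run-compareTops σ v w (lookup σ cmp₁) (lookup σ cmp₂)))
    where
    cost : ∀ b → 8 * b + 8 * b + 4 * (b + b) ≡ 24 * b
    cost = solve-∀
    compare-cost : 4 * (suc (length v) + suc (length w)) ≤ 4 * (β + β)
    compare-cost = *-monoʳ-≤ 4 (+-mono-≤ (s≤s short-v) (s≤s short-w))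
    σ₁ = σ [ cmp₁ ]≔ tok v (lookup σ cmp₁)
    copied : σ₁ [ cmp₂ ]≔ tok w (lookup σ₁ cmp₂) ≡ σ₁ [ cmp₂ ]≔ tok w (lookup σ cmp₂)
    copied = cong (λ s → σ₁ [ cmp₂ ]≔ tok w s) (lookup∘update′ {i = cmp₂} {cmp₁} (λ ()) σ _)
    restored : σ [ cmp₁ ]≔ lookup σ cmp₁ [ cmp₂ ]≔ lookup σ cmp₂ ≡ σ
    restored = trans (cong (_[ cmp₂ ]≔ lookup σ cmp₂) ([]≔-lookup σ cmp₁)) ([]≔-lookup σ cmp₂)

  module _ {i : Fin 10} {visit : M Unit} (F : List Symbol → List Symbol → Stacks {9})
           (at : ∀ p q → lookup (F p q) i ≡ p)
           (f : Name → Name) {c : ℕ}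
           (run-visit : ∀ {w} p q → Short w → visit ∶ F (tok w p) q ⟶[ c ] tt , F p (tok (f w) q)) where

    -- Besides the visit, a round takes 3 steps to peek and 1 to return. The failing peek at the end
    -- makes up the additional round.
    run-pass : ∀ ws us → All Short ws → pass i visit ∶ F (toks ws) (toks us)
               ⟶[ suc (length ws) * (c + 4) ] tt , F [] (toks (map f ws ʳ++ us))
    run-pass []       us []               = slower (≤-by c (trans (+-comm 4 c) (sym (+-identityʳ (c + 4)))))
      (run-last (run-peek-[] (at [] (toks us)) ⨾ run-ret))
    run-pass (w ∷ ws) us (short ∷ shorts) = slower (+-monoˡ-≤ _ (≤-reflexive (cost c)))
      (run-again (run-peek w (at _ _) ⨾ (run-visit _ _ short ⨾ run-ret))
        (run-pass ws (f w ∷ us) shorts))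
      where
      cost : ∀ c → 3 + (c + 1) ≡ c + 4
      cost = solve-∀

  rename-short : ∀ {a b w} → Short a → Short w → Short (rename a b w)
  rename-short {b = b} {w} short-a short with same w b
  ... | true  = short-a
  ... | false = short

  -- Excluding 4 to 9 leaves the stacks 0 to 3, on which lists are kept.
  Pile : Fin 10 → Set
  Pile i = ∀ l → i ≢ 4 ↑ʳ l

  module _ {i : Fin 10} (pile : Pile i) {σ : Stacks {9}} {a b p q}
           (short-a : Short a) (short-b : Short b)
           (at-a : lookup σ fst ≡ tok a p) (at-b : lookup σ snd ≡ tok b q) where

    private
      F : List Symbol → List Symbol → Stacks {9}
      F s t = σ [ i ]≔ s [ aux ]≔ t

      elsewhere : ∀ l → aux ≢ l → i ≢ l → ∀ s t → lookup (F s t) l ≡ lookup σ l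
      elsewhere l aux≢l i≢l s t =
        trans (lookup∘update′ (≢-sym aux≢l) (σ [ i ]≔ s) t) (lookup∘update′ (≢-sym i≢l) σ s)

      i≢aux : i ≢ aux
      i≢aux = pile 2F

    run-replaceTop : ∀ {w} s t → Short w → replaceTop i (same w b) ∶ F (tok w s) t
                     ⟶[ 12 * β ] tt , F s (tok (rename a b w) t)
    run-replaceTop {w} s t short with same w b
    ... | true  = slower (≤-reflexive (sym (*-distribʳ-+ β 4 8)))
      ((to set₁ i≢aux σ _ _ _ , discard-short short (at₁ i≢aux σ _ _)) ⨾
       (to trans (set₂ i≢aux σ _ _ _) (cong (λ u → F s (tok a u)) (at₂ i≢aux σ s t)) ,
        cp-short (λ ()) (λ ()) (λ ()) short-a
          (trans (elsewhere fst (λ ()) (pile 0F) s t) at-a)))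
    ... | false = slower (*-monoˡ-≤ β (m≤n+m 8 4))
      (to moved , mv-short i≢aux (pile 3F) (λ ()) short (at₁ i≢aux σ _ _))
      where
      moved : F (tok w s) t [ i ]≔ s [ aux ]≔ tok w (lookup (F (tok w s) t) aux) ≡ F s (tok w t)
      moved = trans (cong₂ (λ σ′ u → σ′ [ aux ]≔ tok w u) (set₁ i≢aux σ _ t s) (at₂ i≢aux σ _ t))
        (set₂ i≢aux σ s t (tok w t))

    run-renameTop : ∀ {w} s t → Short w → renameTop i ∶ F (tok w s) t
                    ⟶[ 36 * β ] tt , F s (tok (rename a b w) t)
    run-renameTop s t short = slower (≤-reflexive (sym (*-distribʳ-+ β 24 12)))
      (run-test (λ l → pile (3 ↑ʳ l)) (λ _ ()) short short-b (at₁ i≢aux σ _ _)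
         (trans (elsewhere snd (λ ()) (pile 1F) _ t) at-b) ⨾
       run-replaceTop s t short)

    private
      F′ : List Symbol → List Symbol → Stacks {9}
      F′ s t = σ [ aux ]≔ s [ i ]≔ t

    run-return : ∀ {w} s t → Short w → mv aux i ∶ F′ (tok w s) t ⟶[ 8 * β ] tt , F′ s (tok w t)
    run-return {w} s t short =
      to moved , mv-short (≢-sym i≢aux) (λ ()) (pile 3F) short (at₁ (≢-sym i≢aux) σ _ _)
      where
      moved : F′ (tok w s) t [ aux ]≔ s [ i ]≔ tok w (lookup (F′ (tok w s) t) i) ≡ F′ s (tok w t)
      moved = trans (cong₂ (λ σ′ u → σ′ [ i ]≔ tok w u) (set₁ (≢-sym i≢aux) σ _ t s)
                                                        (at₂ (≢-sym i≢aux) σ _ t))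
        (set₂ (≢-sym i≢aux) σ s t (tok w t))

    -- The passes cost 36 `β` + 4 and 8 `β` + 4 per name; as `β` is at least 1, a further 8 `β`
    -- absorbs the constants, which gives 52 `β`.
    run-renameAll : ∀ ws → All Short ws → lookup σ i ≡ toks ws → lookup σ aux ≡ [] →
                    renameAll i ∶ σ ⟶[ suc (length ws) * (52 * β) ] tt , σ [ i ]≔ toks (map (rename a b) ws)
    run-renameAll ws shorts at-i at-aux = slower cost
      ((from begins , run-pass F (at₁ i≢aux σ) (rename a b) run-renameTop ws [] shorts) ⨾
       (from []≔-commutes σ aux i (≢-sym i≢aux) , to ends ,
        run-pass F′ (at₁ (≢-sym i≢aux) σ) id run-return (reverse ws′) []
          (ʳ++⁺ (map⁺ (All.map (λ {w} → rename-short {b = b} {w} short-a) shorts)) [])))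
      where
      ws′ = map (rename a b) ws
      begins : F (toks ws) [] ≡ σ
      begins = trans (cong (_[ aux ]≔ []) (set-same σ at-i)) (set-same σ at-aux)
      ends : F′ [] (toks (reverse (map id (reverse ws′)))) ≡ σ [ i ]≔ toks ws′
      ends = cong₂ (λ σ′ vs → σ′ [ i ]≔ toks vs) (set-same σ at-aux)
        (trans (cong reverse (map-id (reverse ws′))) (reverse-involutive ws′))
      length-ws′ : length (reverse ws′) ≡ length ws
      length-ws′ = trans (length-reverse ws′) (length-map (rename a b) ws)
      split : ∀ n b → suc n * (36 * suc b + 4) + suc n * (8 * suc b + 4) + suc n * (8 * b) ≡ suc n * (52 * suc b)
      split = solve-∀
      cost : suc (length ws) * (36 * β + 4) + suc (length (reverse ws′)) * (8 * β + 4)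
             ≤ suc (length ws) * (52 * β)
      cost = subst (λ l → suc (length ws) * (36 * β + 4) + suc l * (8 * β + 4) ≤ suc (length ws) * (52 * β))
        (sym length-ws′) (≤-by (suc (length ws) * (8 * B)) (split (length ws) B))

-- Contraction of the list of edges

-- The name pushed last lies on top, whence the reversed pairs of `zerosOf` and `undecOf`. An edge
-- outside both `E` and the domain of x̃ settles the answer at once.
place : Maybe Symbol → Maybe Symbol → M (Maybe Bool)
place _          (just val0) = mv fst zeros >> mv snd zeros >> ret nothing
place _          (just val1) =
  cp fst ones >> cp snd ones >> mv snd ones >> mv fst ones >> ret nothing
place (just yes) (just val*) = mv fst undec >> mv snd undec >> ret nothing
place _          _           = ret (just false)

splitStep : Bool → M (Maybe Bool)
splitStep true  = mv inp fst >> mv inp snd >> popM inp >>= λ f → popM inp >>= place f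
splitStep false = ret (just true)

split : M Bool
split = loop (peek inp >>= splitStep)

-- The remaining zeros are renamed as well, since later contractions have to refer to the current
-- names.
contractStep : Bool → M (Maybe Unit)
contractStep true  =
  mv zeros fst >> mv zeros snd >>
  renameAll zeros >> renameAll ones >> renameAll undec >>
  discard fst >> discard snd >> ret nothing
contractStep false = ret (just tt)

contract : M Unit
contract = loop (peek zeros >>= contractStep)

scanStep : Bool → M (Maybe Bool)
scanStep true  =
  test ones fst >>= λ b → mv ones aux >> test ones snd >>= λ b′ → mv ones aux >>
  ret (if b ∧ b′ then just true else nothing)
scanStep false = ret (just false)

scan : M Bool
scan = loop (peek ones >>= scanStep)

-- After a hit the answer is known and the stacks may stay in disorder. Otherwise the pairs set
-- aside on `aux` are put back for the next edge.
afterScan : Bool → M (Maybe Bool)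
afterScan true  = ret (just false)
afterScan false = pass aux (mv aux ones) >> discard fst >> discard snd >> ret nothing

afterTest : Bool → M (Maybe Bool)
afterTest true  = ret (just false)
afterTest false = scan >>= afterScan

checkStep : Bool → M (Maybe Bool)
checkStep true  = mv undec fst >> mv undec snd >> test fst snd >>= afterTest
checkStep false = ret (just true)

check : M Bool
check = loop (peek undec >>= checkStep)

afterSplit : Bool → M Bool
afterSplit true  = contract >> check
afterSplit false = ret false

decider : M Bool
decider = discard inp >> split >>= afterSplit

stacks : (i z d u a b s : List Symbol) → Stacks {9}
stacks i z d u a b s = i ∷ z ∷ d ∷ u ∷ a ∷ b ∷ s ∷ [] ∷ [] ∷ [] ∷ []

Pairs : Set → Set
Pairs A = List (A × A)

module _ {A : Set} where

  -- A pile is seen as a fixed list of pairs of objects under a naming `ν`, so that renaming changes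
  -- `ν` alone.
  names : (A → Name) → Pairs A → List Name
  names ν []             = []
  names ν ((a , b) ∷ ps) = ν a ∷ ν b ∷ names ν ps

  length-names : ∀ ν ps → length (names ν ps) ≡ length ps + length ps
  length-names ν []       = refl
  length-names ν (p ∷ ps) = cong suc (trans (cong suc (length-names ν ps)) (sym (+-suc _ _)))

  map-names : ∀ f ν ps → map f (names ν ps) ≡ names (f ∘ ν) ps
  map-names f ν []             = refl
  map-names f ν ((a , b) ∷ ps) = cong (λ ws → f (ν a) ∷ f (ν b) ∷ ws) (map-names f ν ps)

  all-names : ∀ {P : Name → Set} ν → (∀ a → P (ν a)) → ∀ ps → All P (names ν ps)
  all-names ν p []             = []
  all-names ν p ((a , b) ∷ ps) = p a ∷ p b ∷ all-names ν p ps

  -- Afterwards, two names are equal iff the pairs connect what they name.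
  merge : (A → Name) → Pairs A → A → Name
  merge ν []             = ν
  merge ν ((a , b) ∷ ps) = merge (rename (ν a) (ν b) ∘ ν) ps

  matches : (A → Name) → A → A → A × A → Bool
  matches ν a b (c , d) = same (ν c) (ν a) ∧ same (ν d) (ν b)

  open-pairs : (A → Name) → Pairs A → Pairs A → Bool
  open-pairs ν ds []             = true
  open-pairs ν ds ((a , b) ∷ us) =
    if same (ν a) (ν b) then false else
    if any (matches ν a b) ds then false else open-pairs ν ds us

  Rec : Set
  Rec = A × A × Bool × Maybe (Fin 2)

  input : (A → Name) → List Rec → List Symbol
  input ν []                     = []
  input ν ((a , b , f , v) ∷ rs) =
    tok (ν a) (tok (ν b) (encodeFlag f ∷ encodeValue v ∷ input ν rs))

  -- Edges labelled 1 are kept in both orientations, so that they need to be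
  -- matched against others in only one.
  zerosOf onesOf undecOf : Rec → Pairs A
  zerosOf (a , b , f , just 0F) = (b , a) ∷ []
  zerosOf _                     = []
  onesOf (a , b , f , just 1F)  = (a , b) ∷ (b , a) ∷ []
  onesOf _                      = []
  undecOf (a , b , f , nothing) = (b , a) ∷ []
  undecOf _                     = []

  admissible : Rec → Bool
  admissible (a , b , false , nothing) = false
  admissible _                         = true

  -- Accumulates as a stack does: later records end up on top.
  collect : (Rec → Pairs A) → List Rec → Pairs A → Pairs A
  collect f []       ps = ps
  collect f (r ∷ rs) ps = collect f rs (f r ++ ps)

  accepts : (A → Name) → List Rec → Bool
  accepts ν rs = all admissible rs ∧
    open-pairs (merge ν (collect zerosOf rs [])) (collect onesOf rs []) (collect undecOf rs [])

-- Running time of the decider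

module Cost (B N : ℕ) where
  open Bounded B using (β)

  -- `B` bounds the lengths of names and `N` the number of pairs on a pile, which then holds at most
  -- `N + N` names.
  renameCost contractCost scanCost restoreCost checkCost splitCost totalCost : ℕ
  renameCost   = suc (N + N) * (52 * β)
  contractCost = 8 * β + 8 * β + renameCost + renameCost + renameCost + 4 * β + 4 * β
  scanCost     = 24 * β + (8 * β + 24 * β + 8 * β)
  restoreCost  = suc (N + N) * (8 * β + 4) + 4 * β + 4 * β
  checkCost    = 8 * β + 8 * β + 24 * β + (suc N * (4 + scanCost) + restoreCost)
  splitCost    = 8 * β + 8 * β + 1 + (1 + 32 * β)
  totalCost    =
    4 * β + suc N * (4 + splitCost) + (suc N * (4 + contractCost) + suc N * (4 + checkCost))

module _ (B N : ℕ) {A : Set} where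
  open Bounded B
  open Cost B N

  private
    last-round : ∀ c → 4 ≤ suc 0 * (4 + c)
    last-round c = ≤-by c (sym (*-identityˡ (4 + c)))

    round : ∀ c t → 3 + (c + 1) + t ≡ (4 + c) + t
    round = solve-∀

  module _ (ν : A → Name) (short : ∀ a → Short (ν a)) where

    private
      rename-names : ∀ {i} (pile : Pile i) {σ} a b {p q} ps → length ps ≤ N →
        lookup σ fst ≡ tok (ν a) p → lookup σ snd ≡ tok (ν b) q →
        lookup σ i ≡ toks (names ν ps) → lookup σ aux ≡ [] →
        renameAll i ∶ σ ⟶[ suc (N + N) * (52 * β) ] tt ,
          σ [ i ]≔ toks (names (rename (ν a) (ν b) ∘ ν) ps)
      rename-names {i} pile {σ} a b ps small at-a at-b at-i at-aux =
        to cong (λ ws → σ [ i ]≔ toks ws) (map-names (rename (ν a) (ν b)) ν ps) ,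
        slower (*-monoˡ-≤ (52 * β) (s≤s (subst (_≤ N + N) (sym (length-names ν ps)) (+-mono-≤ small small))))
          (run-renameAll pile (short a) (short b) at-a at-b (names ν ps) (all-names ν short ps) at-i at-aux)

    run-contractStep : ∀ a b zs ds us → length zs ≤ N → length ds ≤ N → length us ≤ N →
      let ν′ = rename (ν a) (ν b) ∘ ν in
      contractStep true ∶
        stacks [] (toks (names ν ((a , b) ∷ zs))) (toks (names ν ds)) (toks (names ν us)) [] [] []
        ⟶[ contractCost + 1 ] nothing ,
        stacks [] (toks (names ν′ zs)) (toks (names ν′ ds)) (toks (names ν′ us)) [] [] []
    run-contractStep a b zs ds us z≤ d≤ u≤ =
      mv-short (λ ()) (λ ()) (λ ()) (short a) refl ⨾
      mv-short (λ ()) (λ ()) (λ ()) (short b) refl ⨾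
      rename-names (λ _ ()) a b zs z≤ refl refl refl refl ⨾
      rename-names (λ _ ()) a b ds d≤ refl refl refl refl ⨾
      rename-names (λ _ ()) a b us u≤ refl refl refl refl ⨾
      discard-short (short a) refl ⨾
      discard-short (short b) refl ⨾
      run-ret

  -- Generalised over `ν`, since every round leaves the same pairs under a new naming; the bound on
  -- name lengths has to be carried along.
  run-contract : ∀ ν → (∀ a → Short (ν a)) → ∀ zs ds us →
    length zs ≤ N → length ds ≤ N → length us ≤ N →
    contract ∶ stacks [] (toks (names ν zs)) (toks (names ν ds)) (toks (names ν us)) [] [] []
      ⟶[ suc (length zs) * (4 + contractCost) ] tt ,
      stacks [] [] (toks (names (merge ν zs) ds)) (toks (names (merge ν zs) us)) [] [] []
  run-contract ν short [] ds us _ _ _ =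
    slower (last-round contractCost) (run-last (run-peek-[] refl ⨾ run-ret))
  run-contract ν short ((a , b) ∷ zs) ds us z≤ d≤ u≤ =
    slower (≤-reflexive (round contractCost _))
      (run-again (run-peek (ν a) refl ⨾
        run-contractStep ν short a b zs ds us (≤-trans (n≤1+n _) z≤) d≤ u≤)
        (run-contract (rename (ν a) (ν b) ∘ ν) (λ c → rename-short {b = ν b} {ν c} (short a) (short c))
          zs ds us (≤-trans (n≤1+n _) z≤) d≤ u≤))

  module _ (ν : A → Name) (short : ∀ a → Short (ν a)) where

    private
      pairs : Pairs A → List Symbol
      pairs ps = toks (names ν ps)

    module _ (us : List Symbol) (a b : A) where

      private
        at : Pairs A → List Name → Stacks {9}
        at ds seen = stacks [] [] (pairs ds) us (tok (ν a) []) (tok (ν b) []) (toks seen)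

      -- The final stacks are specified only for a scan without a hit, the only case in which the
      -- run goes on.
      run-scan : ∀ ds seen → ∃ λ σ →
        (scan ∶ at ds seen ⟶[ suc (length ds) * (4 + scanCost) ] any (matches ν a b) ds , σ) ×
        (any (matches ν a b) ds ≡ false → σ ≡ at [] (names ν ds ʳ++ seen))
      run-scan []             seen = _ ,
        slower (last-round scanCost) (run-last (run-peek-[] refl ⨾ run-ret)) , λ _ → refl
      run-scan ((c , d) ∷ ds) seen = continue (matches ν a b (c , d)) refl
        where
        first : ∀ {m} → matches ν a b (c , d) ≡ m → peek ones >>= scanStep ∶ at ((c , d) ∷ ds) seen
          ⟶[ 3 + (scanCost + 1) ] (if m then just true else nothing) , at ds (ν d ∷ ν c ∷ seen)
        first refl = slower (≤-reflexive (assoc β))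
          (run-peek (ν c) refl ⨾
            (run-test (λ _ ()) (λ _ ()) (short c) (short a) refl refl ⨾
              (mv-short (λ ()) (λ ()) (λ ()) (short c) refl ⨾
               run-test (λ _ ()) (λ _ ()) (short d) (short b) refl refl ⨾
                (mv-short (λ ()) (λ ()) (λ ()) (short d) refl ⨾ run-ret))))
          where
          assoc : ∀ b → 3 + (24 * b + (8 * b + 24 * b + (8 * b + 1))) ≡ 3 + (24 * b + (8 * b + 24 * b + 8 * b) + 1)
          assoc = solve-∀
        continue : ∀ m → matches ν a b (c , d) ≡ m → ∃ λ σ →
          (scan ∶ at ((c , d) ∷ ds) seen ⟶[ suc (suc (length ds)) * (4 + scanCost) ]
            any (matches ν a b) ((c , d) ∷ ds) , σ) ×
          (any (matches ν a b) ((c , d) ∷ ds) ≡ false → σ ≡ at [] (names ν ((c , d) ∷ ds) ʳ++ seen))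
        continue true  eq rewrite eq = _ ,
          slower (≤-trans (m≤m+n _ _) (≤-reflexive (round scanCost _))) (run-last (first eq)) , λ ()
        continue false eq rewrite eq =
          let σ , run , final = run-scan ds (ν d ∷ ν c ∷ seen) in
          σ , slower (≤-reflexive (round scanCost _)) (run-again (first eq) run) , final

    private
      opened : Pairs A → Pairs A → Stacks {9}
      opened ds us = stacks [] [] (pairs ds) (pairs us) [] [] []

    run-restore : ∀ ds us a b → length ds ≤ N → afterScan false ∶
      stacks [] [] [] (pairs us) (tok (ν a) []) (tok (ν b) []) (toks (reverse (names ν ds)))
      ⟶[ restoreCost + 1 ] nothing , opened ds us
    run-restore ds us a b d≤ =
      slower (*-monoˡ-≤ (8 * β + 4) (s≤s short-enough))
        (to cong (λ ws → stacks [] [] (toks ws) (pairs us) (tok (ν a) []) (tok (ν b) []) []) returned ,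
         run-pass (λ s t → stacks [] [] t (pairs us) (tok (ν a) []) (tok (ν b) []) s) (λ _ _ → refl) id
           (λ p q short-w → mv-short (λ ()) (λ ()) (λ ()) short-w refl)
           (reverse (names ν ds)) [] (ʳ++⁺ (all-names ν short ds) [])) ⨾
      discard-short (short a) refl ⨾
      discard-short (short b) refl ⨾
      run-ret
      where
      returned : reverse (map id (reverse (names ν ds))) ≡ names ν ds
      returned = trans (cong reverse (map-id (reverse (names ν ds)))) (reverse-involutive (names ν ds))
      short-enough : length (reverse (names ν ds)) ≤ N + N
      short-enough = subst (_≤ N + N)
        (sym (trans (length-reverse (names ν ds)) (length-names ν ds))) (+-mono-≤ d≤ d≤)

    run-check : ∀ ds us → length ds ≤ N → ∃ λ σ →
      check ∶ opened ds us ⟶[ suc (length us) * (4 + checkCost) ] open-pairs ν ds us , σ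
    run-check ds []             d≤ = _ ,
      slower (last-round checkCost) (run-last (run-peek-[] refl ⨾ run-ret))
    run-check ds ((a , b) ∷ us) d≤ = compared (same (ν a) (ν b)) refl
      where
      searched : Stacks {9}
      searched = stacks [] [] (pairs ds) (pairs us) (tok (ν a) []) (tok (ν b) []) []
      begin-step : ∀ {m t r σ} → same (ν a) (ν b) ≡ m → afterTest m ∶ searched ⟶[ t ] r , σ →
        peek undec >>= checkStep ∶ opened ds ((a , b) ∷ us)
          ⟶[ 3 + (8 * β + 8 * β + 24 * β + t) ] r , σ
      begin-step refl run = run-peek (ν a) refl ⨾
        (mv-short (λ ()) (λ ()) (λ ()) (short a) refl ⨾
         mv-short (λ ()) (λ ()) (λ ()) (short b) refl ⨾
         run-test (λ _ ()) (λ _ ()) (short a) (short b) refl refl ⨾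
         run)
      Goal : Bool → Set
      Goal r = ∃ λ σ → check ∶ opened ds ((a , b) ∷ us) ⟶[ suc (suc (length us)) * (4 + checkCost) ] r , σ
      cost-end : ∀ x y z → 3 + (x + (y + 1)) ≤ suc z * (4 + (x + (y + restoreCost)))
      cost-end x y z = ≤-trans
        (≤-by restoreCost (regroup x y restoreCost)) (m≤m+n (4 + (x + (y + restoreCost))) _)
        where
        regroup : ∀ x y w → 3 + (x + (y + 1)) + w ≡ 4 + (x + (y + w))
        regroup = solve-∀
      cost-next : ∀ x y w t → 3 + (x + (y + (w + 1))) + t ≡ 4 + (x + (y + w)) + t
      cost-next = solve-∀
      found : ∀ m → same (ν a) (ν b) ≡ false → any (matches ν a b) ds ≡ m →
              Goal (if m then false else open-pairs ν ds us)
      compared : ∀ m → same (ν a) (ν b) ≡ m →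
                 Goal (if m then false else if any (matches ν a b) ds then false else open-pairs ν ds us)
      compared true  eq = _ , slower (≤-trans (s≤s (s≤s (s≤s (+-monoʳ-≤ (8 * β + 8 * β + 24 * β) (m≤n+m 1 scans)))))
        (cost-end (8 * β + 8 * β + 24 * β) scans (suc (length us)))) (run-last (begin-step eq run-ret))
        where
        scans : ℕ
        scans = suc N * (4 + scanCost)
      compared false eq = found (any (matches ν a b) ds) eq refl
      found m eq eq′ with run-scan (pairs us) a b ds []
      ... | σ , run , final rewrite eq′ = conclude m final run
        where
        scans : ℕ
        scans = suc N * (4 + scanCost)
        within : suc (length ds) * (4 + scanCost) ≤ scans
        within = *-monoˡ-≤ (4 + scanCost) (s≤s d≤)
        conclude : ∀ m → (m ≡ false → σ ≡ stacks [] [] [] (pairs us) (tok (ν a) []) (tok (ν b) [])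
                                              (toks (reverse (names ν ds)))) →
          scan ∶ searched ⟶[ suc (length ds) * (4 + scanCost) ] m , σ →
          Goal (if m then false else open-pairs ν ds us)
        conclude true  final run = _ ,
          slower (cost-end (8 * β + 8 * β + 24 * β) scans (suc (length us)))
            (run-last (begin-step eq (slower within run ⨾ run-ret)))
        conclude false final run with refl ← final refl =
          let σ′ , rest = run-check ds us d≤ in
          σ′ , slower (≤-reflexive (cost-next (8 * β + 8 * β + 24 * β) scans restoreCost _))
            (run-again (begin-step eq (slower within run ⨾ run-restore ds us a b d≤)) rest)

    run-place : ∀ a b f v rest zs ds us → admissible (a , b , f , v) ≡ true →
      let r = (a , b , f , v) in
      place (just (encodeFlag f)) (just (encodeValue v)) ∶
        stacks rest (pairs zs) (pairs ds) (pairs us) (tok (ν a) []) (tok (ν b) []) []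
        ⟶[ 32 * β + 1 ] nothing ,
        stacks rest (pairs (zerosOf r ++ zs)) (pairs (onesOf r ++ ds)) (pairs (undecOf r ++ us)) [] [] []
    run-place a b f (just 0F) rest zs ds us _ =
      slower (+-monoˡ-≤ 1 (≤-trans (≤-reflexive (sym (*-distribʳ-+ β 8 8))) (*-monoˡ-≤ β (m≤n+m 16 16))))
        (mv-short (λ ()) (λ ()) (λ ()) (short a) refl ⨾
         mv-short (λ ()) (λ ()) (λ ()) (short b) refl ⨾
         run-ret)
    run-place a b f (just 1F) rest zs ds us _ =
      slower (≤-reflexive (four β))
        (cp-short (λ ()) (λ ()) (λ ()) (short a) refl ⨾
         cp-short (λ ()) (λ ()) (λ ()) (short b) refl ⨾
         mv-short (λ ()) (λ ()) (λ ()) (short b) refl ⨾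
         mv-short (λ ()) (λ ()) (λ ()) (short a) refl ⨾
         run-ret)
      where
      four : ∀ b → 8 * b + 8 * b + 8 * b + 8 * b + 1 ≡ 32 * b + 1
      four = solve-∀
    run-place a b true nothing rest zs ds us _ =
      slower (+-monoˡ-≤ 1 (≤-trans (≤-reflexive (sym (*-distribʳ-+ β 8 8))) (*-monoˡ-≤ β (m≤n+m 16 16))))
        (mv-short (λ ()) (λ ()) (λ ()) (short a) refl ⨾
         mv-short (λ ()) (λ ()) (λ ()) (short b) refl ⨾
         run-ret)

    run-place-inadmissible : ∀ (a b : A) f v {σ} → admissible (a , b , f , v) ≡ false →
      place (just (encodeFlag f)) (just (encodeValue v)) ∶ σ ⟶[ 32 * β + 1 ] just false , σ
    run-place-inadmissible a b false nothing _ = slower (m≤n+m 1 (32 * β)) run-ret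

    private
      sorting : List Rec → Pairs A → Pairs A → Pairs A → Stacks {9}
      sorting rs zs ds us = stacks (input ν rs) (pairs zs) (pairs ds) (pairs us) [] [] []

    run-split : ∀ rs zs ds us → ∃ λ σ →
      (split ∶ sorting rs zs ds us ⟶[ suc (length rs) * (4 + splitCost) ] all admissible rs , σ) ×
      (all admissible rs ≡ true →
       σ ≡ sorting [] (collect zerosOf rs zs) (collect onesOf rs ds) (collect undecOf rs us))
    run-split [] zs ds us = _ ,
      slower (last-round splitCost) (run-last (run-peek-[] refl ⨾ run-ret)) , λ _ → refl
    run-split (r@(a , b , f , v) ∷ rs) zs ds us = placed (admissible r) refl
      where
      sorted : ∀ {m σ} → place (just (encodeFlag f)) (just (encodeValue v)) ∶
          stacks (input ν rs) (pairs zs) (pairs ds) (pairs us) (tok (ν a) []) (tok (ν b) []) []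
          ⟶[ 32 * β + 1 ] m , σ →
        peek inp >>= splitStep ∶ sorting (r ∷ rs) zs ds us ⟶[ 3 + (splitCost + 1) ] m , σ
      sorted run = slower (≤-reflexive (assoc (8 * β + 8 * β + 1) (32 * β)))
        (run-peek (ν a) refl ⨾
          (mv-short (λ ()) (λ ()) (λ ()) (short a) refl ⨾
           mv-short (λ ()) (λ ()) (λ ()) (short b) refl ⨾
           run-pop refl ⨾ (run-pop refl ⨾ run)))
        where
        assoc : ∀ x y → 3 + (x + (1 + (y + 1))) ≡ 3 + (x + (1 + y) + 1)
        assoc = solve-∀
      placed : ∀ m → admissible r ≡ m → ∃ λ σ →
        (split ∶ sorting (r ∷ rs) zs ds us
          ⟶[ suc (suc (length rs)) * (4 + splitCost) ] all admissible (r ∷ rs) , σ) ×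
        (all admissible (r ∷ rs) ≡ true →
         σ ≡ sorting [] (collect zerosOf (r ∷ rs) zs) (collect onesOf (r ∷ rs) ds) (collect undecOf (r ∷ rs) us))
      placed false eq rewrite eq = _ ,
        slower (≤-trans (m≤m+n _ _) (≤-reflexive (round splitCost _)))
          (run-last (sorted (run-place-inadmissible a b f v eq))) , λ ()
      placed true  eq rewrite eq =
        let σ , run , final = run-split rs (zerosOf r ++ zs) (onesOf r ++ ds) (undecOf r ++ us) in
        σ , slower (≤-reflexive (round splitCost _))
              (run-again (sorted (run-place a b f v (input ν rs) zs ds us eq)) run) , final

length-collect : ∀ {A : Set} c (f : Rec {A} → Pairs A) → (∀ r → length (f r) ≤ c) →
                 ∀ rs ps → length (collect f rs ps) ≤ length rs * c + length ps
length-collect c f bound []       ps = ≤-refl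
length-collect c f bound (r ∷ rs) ps = ≤-trans (length-collect c f bound rs (f r ++ ps))
  (≤-trans (+-monoʳ-≤ (length rs * c)
    (≤-trans (≤-reflexive (length-++ (f r))) (+-monoˡ-≤ (length ps) (bound r))))
    (≤-reflexive (regroup (length rs * c) c (length ps))))
  where
  regroup : ∀ x y z → x + (y + z) ≡ y + x + z
  regroup = solve-∀

-- Renaming only reuses names, so the bound survives any number of contractions.
merge-short : ∀ B {A : Set} (ν : A → Name) → (∀ a → length (ν a) ≤ B) →
              ∀ ps a → length (merge ν ps a) ≤ B
merge-short B ν short []             c = short c
merge-short B ν short ((a , b) ∷ ps) c =
  merge-short B (rename (ν a) (ν b) ∘ ν)
    (λ d → Bounded.rename-short B {b = ν b} {ν d} (short a) (short d)) ps c

run-decider : ∀ B {A : Set} (ν : A → Name) → (∀ a → length (ν a) ≤ B) →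
  ∀ h → length h ≤ B → ∀ rs → length rs ≤ B → ∃ λ σ →
  decider ∶ tok h (input ν rs) Vec.∷ Vec.replicate 9 []
    ⟶[ Cost.totalCost B (B * 2) ] accepts ν rs , σ
run-decider B {A} ν short h short-h rs few = sorted (all admissible rs) refl
  where
  open Bounded B using (β; discard-short)
  -- An edge labelled 1 contributes two pairs, one for each orientation.
  N : ℕ
  N = B * 2
  open Cost B N
  zs ds us : Pairs A
  zs = collect zerosOf rs []
  ds = collect onesOf rs []
  us = collect undecOf rs []
  zs≤ : length zs ≤ N
  zs≤ = ≤-trans (length-collect 2 zerosOf bound rs []) (≤-trans (≤-reflexive (+-identityʳ (length rs * 2))) (*-monoˡ-≤ 2 few))
    where
    bound : ∀ r → length (zerosOf {A} r) ≤ 2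
    bound (_ , _ , _ , just 0F) = s≤s z≤n
    bound (_ , _ , _ , just 1F) = z≤n
    bound (_ , _ , _ , nothing) = z≤n
  ds≤ : length ds ≤ N
  ds≤ = ≤-trans (length-collect 2 onesOf bound rs []) (≤-trans (≤-reflexive (+-identityʳ (length rs * 2))) (*-monoˡ-≤ 2 few))
    where
    bound : ∀ r → length (onesOf {A} r) ≤ 2
    bound (_ , _ , _ , just 0F) = z≤n
    bound (_ , _ , _ , just 1F) = ≤-refl
    bound (_ , _ , _ , nothing) = z≤n
  us≤ : length us ≤ N
  us≤ = ≤-trans (length-collect 2 undecOf bound rs []) (≤-trans (≤-reflexive (+-identityʳ (length rs * 2))) (*-monoˡ-≤ 2 few))
    where
    bound : ∀ r → length (undecOf {A} r) ≤ 2
    bound (_ , _ , _ , just 0F) = z≤n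
    bound (_ , _ , _ , just 1F) = z≤n
    bound (_ , _ , _ , nothing) = s≤s z≤n
  rs≤ : length rs ≤ N
  rs≤ = ≤-trans few (m≤m*n B 2)
  Goal : Bool → Set
  Goal r = ∃ λ σ → decider ∶ tok h (input ν rs) Vec.∷ Vec.replicate 9 [] ⟶[ totalCost ] r , σ
  sorted : ∀ m → all admissible rs ≡ m → Goal (m ∧ open-pairs (merge ν zs) ds us)
  sorted m eq with run-split B N ν short rs [] [] []
  ... | σ , run , final rewrite eq = conclude m final run
    where
    within : ∀ {k} c → k ≤ N → suc k * (4 + c) ≤ suc N * (4 + c)
    within c k≤ = *-monoˡ-≤ (4 + c) (s≤s k≤)
    conclude : ∀ m →
      (m ≡ true → σ ≡ stacks [] (toks (names ν zs)) (toks (names ν ds)) (toks (names ν us)) [] [] []) →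
      split ∶ stacks (input ν rs) [] [] [] [] [] [] ⟶[ suc (length rs) * (4 + splitCost) ] m , σ →
      Goal (m ∧ open-pairs (merge ν zs) ds us)
    conclude false final run = _ ,
      slower (+-mono-≤ (+-monoʳ-≤ (4 * β) (within splitCost rs≤)) (s≤s z≤n))
        (discard-short short-h refl ⨾ run ⨾ run-ret)
    conclude true  final run with refl ← final refl =
      let σ′ , checked = run-check B N (merge ν zs) (merge-short B ν short zs) ds us ds≤ in
      σ′ , slower (+-mono-≤ (+-monoʳ-≤ (4 * β) (within splitCost rs≤))
                   (+-mono-≤ (within contractCost zs≤) (within checkCost us≤)))
        (discard-short short-h refl ⨾ run ⨾
          (run-contract B N ν short zs ds us zs≤ ds≤ us≤ ⨾ checked))

-- The factor 2 pays for the translation to tapes. The constant 10000 is generous: at `suc n` the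
-- two sides differ by a polynomial in `n` with nonnegative coefficients.
run-time : ∀ n → 2 * Cost.totalCost n (n * 2) ≤ 10000 * n ^ 3 + 10000
run-time zero    = ≤ᵇ⇒≤ _ _ tt
-- `l` stands for `suc (N + N)`, replaced by `5 + n * 4` before the polynomials are compared.
run-time (suc n) = subst (λ l → 2 * (4 * β + (3 + n * 2) * (4 + splitCost) + ((3 + n * 2) * (4 + contracting l) + (3 + n * 2) * (4 + checking l)))
    ≤ 10000 * suc n ^ 3 + 10000) (sym (four n))
  (≤-by (6864 * (n * n * n) + 14400 * (n * n) + 4408 * n + 6124) (expand n))
  where
  open Bounded (suc n) using (β)
  open Cost (suc n) (suc n * 2) using (scanCost; splitCost)
  contracting checking : ℕ → ℕ
  contracting l = 8 * β + 8 * β + l * (52 * β) + l * (52 * β) + l * (52 * β) + 4 * β + 4 * β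
  checking l = 8 * β + 8 * β + 24 * β + ((3 + n * 2) * (4 + scanCost) + (l * (8 * β + 4) + 4 * β + 4 * β))
  four : ∀ n → 3 + n * 2 + (2 + n * 2) ≡ 5 + n * 4
  four = solve-∀
  expand : ∀ n → 2 * (4 * (2 + n) + (3 + n * 2) * (4 + (8 * (2 + n) + 8 * (2 + n) + 1 + (1 + 32 * (2 + n)))) +
      ((3 + n * 2) * (4 + (8 * (2 + n) + 8 * (2 + n) + (5 + n * 4) * (52 * (2 + n)) + (5 + n * 4) * (52 * (2 + n)) + (5 + n * 4) * (52 * (2 + n)) + 4 * (2 + n) + 4 * (2 + n))) +
       (3 + n * 2) * (4 + (8 * (2 + n) + 8 * (2 + n) + 24 * (2 + n) + ((3 + n * 2) * (4 + (24 * (2 + n) + (8 * (2 + n) + 24 * (2 + n) + 8 * (2 + n)))) + ((5 + n * 4) * (8 * (2 + n) + 4) + 4 * (2 + n) + 4 * (2 + n)))))))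
    + (6864 * (n * n * n) + 14400 * (n * n) + 4408 * n + 6124)
    ≡ 10000 * ((1 + n) * ((1 + n) * ((1 + n) * 1))) + 10000
  expand = solve-∀

-- Paths, cycles and cuts

∑-zero : ∀ {m} (S : Subset m) f → (∀ e → e ∈ S → f e ≡ 0) → ∑ S f ≡ 0
∑-zero []            f z = refl
∑-zero (inside ∷ S)  f z = cong₂ _+_ (z 0F here) (∑-zero S _ (λ e → z (Fin.suc e) ∘ there))
∑-zero (outside ∷ S) f z = ∑-zero S _ (λ e → z (Fin.suc e) ∘ there)

∑-zero⁻¹ : ∀ {m} (S : Subset m) f → ∑ S f ≡ 0 → ∀ e → e ∈ S → f e ≡ 0
∑-zero⁻¹ (inside ∷ S)  f eq 0F          here      = m+n≡0⇒m≡0 (f 0F) eq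
∑-zero⁻¹ (inside ∷ S)  f eq (Fin.suc e) (there i) = ∑-zero⁻¹ S _ (m+n≡0⇒n≡0 (f 0F) eq) e i
∑-zero⁻¹ (outside ∷ S) f eq (Fin.suc e) (there i) = ∑-zero⁻¹ S _ eq e i

∈─⇒∉ : ∀ {m} (p q : Subset m) {e} → e ∈ p ─ q → e ∉ q
∈─⇒∉ (_ ∷ p) (outside ∷ q) (there e∈) (there e∈q) = ∈─⇒∉ p q e∈ e∈q
∈─⇒∉ (_ ∷ p) (inside ∷ q)  (there e∈) (there e∈q) = ∈─⇒∉ p q e∈ e∈q

toℕ≡0⇒≡0F : ∀ {i : Fin 2} → toℕ i ≡ 0 → i ≡ 0F
toℕ≡0⇒≡0F {0F} _ = refl

module Walks (G′ : Graph) where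
  open Graph G′

  joins-sym : ∀ {e u v} → Joins G′ e u v → Joins G′ e v u
  joins-sym = Sum.swap

  joins-ends : ∀ e → Joins G′ e (proj₁ (ends e)) (proj₂ (ends e))
  joins-ends e = inj₁ refl

  joins-determines : ∀ {e u v w} → Joins G′ e u v → Joins G′ e u w → v ≡ w
  joins-determines (inj₁ p) (inj₁ q) = cong proj₂ (trans (sym p) q)
  joins-determines (inj₁ p) (inj₂ q) with refl ← trans (sym p) q = refl
  joins-determines (inj₂ p) (inj₁ q) with refl ← trans (sym p) q = refl
  joins-determines (inj₂ p) (inj₂ q) = cong proj₁ (trans (sym p) q)

  joins-injective : ∀ {e f u v} → Joins G′ e u v → Joins G′ f u v → e ≡ f
  joins-injective (inj₁ p) (inj₁ q) = injective (trans p (sym q))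
  joins-injective (inj₂ p) (inj₂ q) = injective (trans p (sym q))
  joins-injective {e} {f} (inj₁ p) (inj₂ q) = contradiction
    (subst (λ (a , b) → a < b) q (ordered f)) (<-asym (subst (λ (a , b) → a < b) p (ordered e)))
  joins-injective {e} {f} (inj₂ p) (inj₁ q) = contradiction
    (subst (λ (a , b) → a < b) q (ordered f)) (<-asym (subst (λ (a , b) → a < b) p (ordered e)))

  ∈edgeSet⁻ : ∀ {S v w} (p : Walk G′ S v w) {e} → e ∈ edgeSet p → e ∈ₗ edges p
  ∈edgeSet⁻ []             e∈ = contradiction e∈ ∉⊥
  ∈edgeSet⁻ (step f _ _ p) e∈ with x∈p∪q⁻ _ _ e∈
  ... | inj₁ i = here (x∈⁅y⁆⇒x≡y f i)
  ... | inj₂ i = there (∈edgeSet⁻ p i)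

  ∈edgeSet⁺ : ∀ {S v w} (p : Walk G′ S v w) {e} → e ∈ₗ edges p → e ∈ edgeSet p
  ∈edgeSet⁺ (step f _ _ p) (here refl) = x∈p∪q⁺ (inj₁ (x∈⁅x⁆ f))
  ∈edgeSet⁺ (step f _ _ p) (there i)   = x∈p∪q⁺ (inj₂ (∈edgeSet⁺ p i))

  embed-walk : ∀ {S S′ v w} → S ⊆ S′ → Walk G′ S v w → Walk G′ S′ v w
  embed-walk sub []               = []
  embed-walk sub (step e e∈ j p) = step e (sub e∈) j (embed-walk sub p)

  targets-embed : ∀ {S S′ v w} (sub : S ⊆ S′) (p : Walk G′ S v w) → targets (embed-walk sub p) ≡ targets p
  targets-embed sub []              = refl
  targets-embed sub (step e e∈ j p) = cong (_ ∷_) (targets-embed sub p)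

  edges-embed : ∀ {S S′ v w} (sub : S ⊆ S′) (p : Walk G′ S v w) → edges (embed-walk sub p) ≡ edges p
  edges-embed sub []              = refl
  edges-embed sub (step e e∈ j p) = cong (e ∷_) (edges-embed sub p)

  edges⊆ : ∀ {S v w} (p : Walk G′ S v w) {e} → e ∈ₗ edges p → e ∈ S
  edges⊆ (step e e∈ j p) (here refl) = e∈
  edges⊆ (step e e∈ j p) (there i)   = edges⊆ p i

  end∈targets : ∀ {S v w} (p : Walk G′ S v w) → w ∈ₗ (v ∷ targets p)
  end∈targets []             = here refl
  end∈targets (step _ _ _ p) = there (end∈targets p)

  ends∈targets : ∀ {S v w} (p : Walk G′ S v w) {e a b} → e ∈ₗ edges p → Joins G′ e a b → a ∈ₗ (v ∷ targets p)
  ends∈targets (step e _ j p) (there i) j′ = there (ends∈targets p i j′)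
  ends∈targets (step e _ (inj₁ j) p) (here refl) (inj₁ j′) = here (cong proj₁ (trans (sym j′) j))
  ends∈targets (step e _ (inj₁ j) p) (here refl) (inj₂ j′) = there (here (cong proj₂ (trans (sym j′) j)))
  ends∈targets (step e _ (inj₂ j) p) (here refl) (inj₁ j′) = there (here (cong proj₁ (trans (sym j′) j)))
  ends∈targets (step e _ (inj₂ j) p) (here refl) (inj₂ j′) = here (cong proj₂ (trans (sym j′) j))

  module _ {S : Subset m} (P : Fin m → Set) where

    -- Restricting the edges by `P` rather than by shrinking `S` keeps walks in the graph to which
    -- the constraints of `X` refer.
    WalkIn PathIn : Fin n → Fin n → Set
    WalkIn v w = ∃ λ (p : Walk G′ S v w) → All P (edges p)
    PathIn v w = ∃ λ (p : Walk G′ S v w) → All P (edges p) × Unique (v ∷ targets p)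

    walk-trans : ∀ {u v w} → WalkIn u v → WalkIn v w → WalkIn u w
    walk-trans ([] , _)                    q = q
    walk-trans (step e e∈ j p , (pe ∷ ps)) q =
      let r , rs = walk-trans (p , ps) q in step e e∈ j r , pe ∷ rs

    walk-edge : ∀ {e u v} → e ∈ S → Joins G′ e u v → P e → WalkIn u v
    walk-edge e∈ j pe = step _ e∈ j [] , pe ∷ []

    walk-sym : ∀ {u v} → WalkIn u v → WalkIn v u
    walk-sym ([] , _)                    = [] , []
    walk-sym (step e e∈ j p , (pe ∷ ps)) = walk-trans (walk-sym (p , ps)) (walk-edge e∈ (joins-sym j) pe)

    suffix : ∀ {u v w} ((p , _) : PathIn v w) → u ∈ₗ (v ∷ targets p) → PathIn u w
    suffix p                                   (here refl) = p
    suffix (step e e∈ j p , _ ∷ ps , _ ∷ uniq) (there i)   = suffix (p , ps , uniq) i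

    -- If the first node recurs on the path found for the rest, only the part from that recurrence
    -- on is kept.
    erase-loops : ∀ {v w} → WalkIn v w → PathIn v w
    erase-loops ([] , _)                = [] , [] , [] ∷ []
    erase-loops {v} (step e e∈ j p , pe ∷ ps) with erase-loops (p , ps)
    ... | q , qs , uniq with _∈?_ _≟_ v (_ ∷ targets q)
    ...   | yea i = suffix (q , qs , uniq) i
    ...   | nay i = step e e∈ j q , pe ∷ qs , ¬Any⇒All¬ _ i ∷ uniq

  edgeSet-empty-sum : ∀ {S v w} (p : Walk G′ S v w) f → All (λ e → f e ≡ 0) (edges p) →
                      ∑ (edgeSet p) f ≡ 0
  edgeSet-empty-sum p f zs = ∑-zero (edgeSet p) f (λ e e∈ → All.lookup zs (∈edgeSet⁻ p e∈))

  Zero : (Fin m → Fin 2) → Fin m → Set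
  Zero x e = x e ≡ 0F

  module _ {E : Subset m} {x : Fin m → Fin 2} (x∈X : X G′ E x) where

    zero-path⇒zero : ∀ {f} → f ∈ ∁ E → let v , w = ends f in PathIn {E} (Zero x) v w → x f ≡ 0F
    zero-path⇒zero {f} f∉ (p , zs , uniq) = toℕ≡0⇒≡0F (n≤0⇒n≡0
      (subst (toℕ (x f) ≤_) (edgeSet-empty-sum p (toℕ ∘ x) (All.map (cong toℕ) zs))
        (X.path x∈X f f∉ (edgeSet p) (p , uniq , refl))))

    -- Unless f lies on the path of zeros, the two form a cycle.
    zero-walk⇒zero : ∀ {f v w} → f ∈ E → Joins G′ f v w → v ≢ w → WalkIn {E} (Zero x) v w → x f ≡ 0F
    zero-walk⇒zero {f} {v} {w} f∈ j v≢w walk with erase-loops (Zero x) walk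
    ... | p , zs , uniq with _∈?_ _≟_ f (edges p)
    ...   | yea f∈p = All.lookup zs f∈p
    ...   | nay f∉p = toℕ≡0⇒≡0F (n≤0⇒n≡0
      (subst (toℕ (x f) ≤_) (∑-zero (edgeSet c - f) (toℕ ∘ x) others)
        (X.cycle x∈X (edgeSet c) (w , c , uniq , long p v≢w f∉p , refl) f (∈edgeSet⁺ c (here refl)))))
      where
      c : Walk G′ E w w
      c = step f f∈ (joins-sym j) p
      -- A single edge would join the same ends as f, hence be f, because the graph is simple.
      long : ∀ (p : Walk G′ E v w) → v ≢ w → f ∉ₗ edges p → 3 ≤ suc (length (edges p))
      long []                             v≢w _   = contradiction refl v≢w
      long (step e _ j′ [])               _   f∉p = contradiction (here (joins-injective j j′)) f∉p
      long (step _ _ _ (step _ _ _ _))    _   _   = s≤s (s≤s (s≤s z≤n))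
      others : ∀ e → e ∈ edgeSet c - f → toℕ (x e) ≡ 0
      others e e∈ with ∈edgeSet⁻ c (p─q⊆p (edgeSet c) _ e∈)
      ... | here refl = contradiction (x∈⁅x⁆ f) (∈─⇒∉ (edgeSet c) _ e∈)
      ... | there i   = cong toℕ (All.lookup zs i)

  -- A second use of e would visit its end u again.
  first-edge-unique : ∀ {S e u v w} (p : Walk G′ S v w) → Joins G′ e u v → Unique (u ∷ v ∷ targets p) →
                      e ∉ₗ edges p
  first-edge-unique p j (u∉ ∷ _) e∈p = All¬⇒¬Any u∉ (ends∈targets p e∈p j)

  -- Labellings that come from partitions of the nodes

  module _ {B : Set} (g : Fin n → B) where

    -- The fibres of `g` are the blocks of a partition; these are the edges within blocks.
    Level : Fin m → Set
    Level e = ∀ {a b} → Joins G′ e a b → g a ≡ g b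

    level-walk : ∀ {S v w} (p : Walk G′ S v w) → (∀ {e} → e ∈ₗ edges p → Level e) → g v ≡ g w
    level-walk []             lev = refl
    level-walk (step e _ j p) lev = trans (lev (here refl) j) (level-walk p (lev ∘ there))

    -- `g` is constant on the two pieces that remain when e is taken out. That e occurs only once
    -- follows from the distinctness of the nodes.
    level-path : ∀ {S v w e} (p : Walk G′ S v w) → Unique (v ∷ targets p) → e ∈ₗ edges p →
                 (∀ {f} → f ∈ₗ edges p → f ≢ e → Level f) →
                 ∃₂ λ a b → Joins G′ e a b × g v ≡ g a × g b ≡ g w
    level-path (step e _ j p) uniq (here refl) lev = _ , _ , j , refl ,
      level-walk p (λ f∈ → lev (there f∈) (λ { refl → first-edge-unique p j uniq f∈ }))
    level-path (step f _ j p) uniq@(_ ∷ uniq′) (there e∈) lev =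
      let a , b , j′ , va , bw = level-path p uniq′ e∈ (lev ∘ there) in
      a , b , j′ , trans (lev (here refl) (λ { refl → first-edge-unique p j uniq e∈ }) j) va , bw

    level-joined : ∀ {e a b} → Joins G′ e a b → g a ≡ g b → Level e
    level-joined (inj₁ j) eq (inj₁ j′) with refl ← trans (sym j) j′ = eq
    level-joined (inj₁ j) eq (inj₂ j′) with refl ← trans (sym j) j′ = sym eq
    level-joined (inj₂ j) eq (inj₁ j′) with refl ← trans (sym j) j′ = sym eq
    level-joined (inj₂ j) eq (inj₂ j′) with refl ← trans (sym j) j′ = eq

    -- Used again at once, e would return to u before the cycle closes there; used later, it would
    -- visit v again. The length excludes the closed walk that goes along e and straight back.
    first-edge-of-cycle-unique : ∀ {S e u v} (p : Walk G′ S v u) → Joins G′ e u v → Unique (v ∷ targets p) →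
                                 2 ≤ length (edges p) → e ∉ₗ edges p
    first-edge-of-cycle-unique (step _ _ j′ p) j (v∉ ∷ _) long (there e∈) =
      All¬⇒¬Any v∉ (ends∈targets p e∈ (joins-sym j))
    first-edge-of-cycle-unique (step _ _ j′ (step _ _ _ p)) j (_ ∷ u∉ ∷ _) long (here refl)
      with refl ← joins-determines (joins-sym j) j′ = All¬⇒¬Any u∉ (end∈targets p)
    first-edge-of-cycle-unique (step _ _ _ []) _ _ (s≤s ()) (here refl)

    -- A cycle cannot cross between blocks exactly once: the other edges lead from one end of e to
    -- the other without leaving the block. The cases are whether the given walk starts with e or
    -- passes it later.
    level-cycle : ∀ {S C} → IsCycle G′ S C → ∀ {e} → e ∈ C → (∀ {f} → f ∈ C → f ≢ e → Level f) → Level e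
    level-cycle (v , step e₀ e₀∈ j p , uniq , s≤s long , refl) {e} e∈ lev
      with ∈edgeSet⁻ (step e₀ e₀∈ j p) e∈
    ... | here refl = level-joined j (sym (level-walk p (λ f∈ → lev (∈edgeSet⁺ (step e₀ e₀∈ j p) (there f∈))
            (λ { refl → first-edge-of-cycle-unique p j uniq long f∈ }))))
    ... | there e∈p =
      let a , b , j′ , va , bw = level-path p uniq e∈p (λ f∈ → lev (∈edgeSet⁺ (step e₀ e₀∈ j p) (there f∈)))
      in  level-joined j′ (trans (sym va) (trans (sym (lev (∈edgeSet⁺ (step e₀ e₀∈ j p) (here refl))
            (λ { refl → first-edge-of-cycle-unique p j uniq long e∈p }) j)) (sym bw)))

    -- A cycle inequality fails only where exactly one edge of the cycle is labelled 1, which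
    -- `level-cycle` excludes. The other two families are empty, as no edge lies outside `E`.
    labelling∈X : ∀ {E x} → (∀ e → e ∈ E) → (∀ e → x e ≡ 0F → Level e) → (∀ e → Level e → x e ≡ 0F) →
                  X G′ E x
    labelling∈X {E} {x} full sound complete = record
      { cycle = λ C cyc e e∈ → bound C cyc e e∈ (x e) refl
      ; path  = λ f f∉ → contradiction (full f) (x∈∁p⇒x∉p f∉)
      ; cut   = λ f f∉ → contradiction (full f) (x∈∁p⇒x∉p f∉)
      }
      where
      bound : ∀ C → IsCycle G′ E C → ∀ e → e ∈ C → ∀ b → x e ≡ b → toℕ b ≤ ∑ (C - e) (toℕ ∘ x)
      bound C cyc e e∈ 0F _  = z≤n
      bound C cyc e e∈ 1F eq with ∑ (C - e) (toℕ ∘ x) in sum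
      ... | suc _ = s≤s z≤n
      ... | zero  = contradiction (trans (sym eq) (complete e (level-cycle cyc e∈ λ {f} f∈ f≢e →
        sound f (toℕ≡0⇒≡0F (∑-zero⁻¹ (C - e) (toℕ ∘ x) sum f (x∈p∧x≢y⇒x∈p-y f∈ f≢e)))))) λ ()

  -- Either `C` is minimal or a strictly smaller set still separates, to which induction on the
  -- bound `k` applies. The double negation avoids deciding separation, and suffices because the use
  -- is a refutation.
  minimal-cut : ∀ {E v w} k C → ∣ C ∣ ≤ k → C ⊆ E → Separates G′ E v w C →
                ¬ ¬ (∃ λ D → D ⊆ C × IsCut G′ E v w D)
  minimal-cut {E} {v} {w} k C ∣C∣≤k C⊆E sep none = none (C , id , C⊆E , sep , minimal k ∣C∣≤k)
    where
    minimal : ∀ k → ∣ C ∣ ≤ k → ∀ D → D ⊆ C → Separates G′ E v w D → C ⊆ D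
    minimal k ∣C∣≤k D D⊆C sep-D {e} e∈C with e ∈S? D
    ... | yea e∈D = e∈D
    ... | nay e∉D with k | ≤-trans (p⊂q⇒∣p∣<∣q∣ (D⊆C , e , e∈C , e∉D)) ∣C∣≤k
    ...   | suc k′ | s≤s ∣D∣≤k′ = contradiction
      (λ (D′ , D′⊆D , cut) → none (D′ , D⊆C ∘ D′⊆D , cut))
      (minimal-cut k′ D ∣D∣≤k′ (C⊆E ∘ D⊆C) sep-D)

  module _ {E : Subset m} {x x′ : Fin m → Fin 2} (x∈X : X G′ E x) (x′∈X : X G′ E x′)
           (agree : ∀ e → e ∈ E → x e ≡ x′ e) where

    private
      cutEdges : Subset m
      cutEdges = Vec.tabulate (λ e → does (e ∈S? E) ∧ does (x e ≟ 1F))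

    -- If x f = 0 and x′ f = 1, then the edges of E labelled 1 contain a cut
    -- between the ends of f, as a path of zeros would force x′ f = 0.
    zero-agrees : ∀ {f} → f ∈ ∁ E → x f ≡ 0F → x′ f ≡ 0F
    zero-agrees {f} f∉ xf≡0 with x′ f in x′f
    ... | 0F = refl
    ... | 1F = contradiction (λ (D , D⊆ , cut) → cut-bound D D⊆ cut)
                 (minimal-cut ∣ cutEdges ∣ cutEdges ≤-refl (proj₁ ∘ ∈cut⁻) separates)
      where
      ∈cut⁻ : ∀ {e} → e ∈ cutEdges → e ∈ E × x e ≡ 1F
      ∈cut⁻ {e} e∈ with e ∈S? E | x e ≟ 1F | trans (sym (lookup∘tabulate _ e)) ([]=⇒lookup e∈)
      ... | yea e∈E | yea xe≡1 | _ = e∈E , xe≡1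
      ... | yea _   | nay _    | ()
      ... | nay _   | _        | ()
      ∈cut⁺ : ∀ {e} → e ∈ E → x e ≡ 1F → e ∈ cutEdges
      ∈cut⁺ {e} e∈E xe≡1 = lookup⇒[]= e cutEdges (trans (lookup∘tabulate _ e)
        (cong₂ _∧_ (dec-true (e ∈S? E) e∈E) (dec-true (x e ≟ 1F) xe≡1)))
      ¬1⇒0 : ∀ {i : Fin 2} → i ≢ 1F → i ≡ 0F
      ¬1⇒0 {0F} _   = refl
      ¬1⇒0 {1F} 1≢1 = contradiction refl 1≢1
      separates : Separates G′ E _ _ cutEdges
      separates (_ , p , uniq , _) = contradiction (trans (sym x′f) (zero-path⇒zero x′∈X f∉
        ( embed-walk (p─q⊆p E cutEdges) p
        , All.tabulate (λ {e} e∈ → zero-on-p (subst (e ∈ₗ_) (edges-embed _ p) e∈))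
        , subst (λ ts → Unique (_ ∷ ts)) (sym (targets-embed _ p)) uniq))) λ ()
        where
        zero-on-p : ∀ {e} → e ∈ₗ edges p → x′ e ≡ 0F
        zero-on-p {e} e∈ = trans (sym (agree e e∈E))
          (¬1⇒0 (λ xe≡1 → ∈─⇒∉ E cutEdges (edges⊆ p e∈) (∈cut⁺ e∈E xe≡1)))
          where e∈E = p─q⊆p E cutEdges (edges⊆ p e∈)
      -- Constraint (iii) for f and this cut would read 1 ≤ 0: f is labelled 0 and every edge of the
      -- cut 1.
      cut-bound : ∀ D → D ⊆ cutEdges → ¬ IsCut G′ E _ _ D
      cut-bound D D⊆ cut = contradiction
        (subst₂ (λ b s → 1 ∸ toℕ b ≤ s) xf≡0
          (∑-zero D _ (λ e e∈ → cong (λ b → 1 ∸ toℕ b) (proj₂ (∈cut⁻ (D⊆ e∈)))))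
          (X.cut x∈X f f∉ D cut)) λ ()

  -- If the labels of an edge outside `E` differed, one of them would be 0, and `zero-agrees`
  -- carries a 0 over in either direction.
  agree-on-E⇒agree : ∀ {E x x′} → X G′ E x → X G′ E x′ → (∀ e → e ∈ E → x e ≡ x′ e) → ∀ f → x f ≡ x′ f
  agree-on-E⇒agree {E} {x} {x′} x∈X x′∈X agree f with f ∈S? E
  ... | yea f∈E = agree f f∈E
  ... | nay f∉E with x f in xf | x′ f in x′f
  ...   | 0F | 0F = refl
  ...   | 1F | 1F = refl
  ...   | 0F | 1F = trans (sym (zero-agrees x∈X x′∈X agree (x∉p⇒x∈∁p f∉E) xf)) x′f
  ...   | 1F | 0F = trans (sym xf) (zero-agrees x′∈X x∈X (λ e → sym ∘ agree e) (x∉p⇒x∈∁p f∉E) x′f)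

-- Correctness of the criterion

rename-≡ : ∀ a b {v w} → rename a b v ≡ rename a b w → v ≡ w ⊎ (v ≡ b × w ≡ a) ⊎ (v ≡ a × w ≡ b)
rename-≡ a b {v} {w} eq with same v b in vb | same w b in wb
... | true  | true  = inj₁ (trans (same⇒≡ v b vb) (sym (same⇒≡ w b wb)))
... | true  | false = inj₂ (inj₁ (same⇒≡ v b vb , sym eq))
... | false | true  = inj₂ (inj₂ (eq , same⇒≡ w b wb))
... | false | false = inj₁ eq

rename-joins : ∀ a b → rename a b a ≡ rename a b b
rename-joins a b with same a b | same b b | same-refl b
... | true  | true | _ = refl
... | false | true | _ = refl

module _ {A : Set} where

  merge-cong : ∀ (ν : A → Name) ps {x y} → ν x ≡ ν y → merge ν ps x ≡ merge ν ps y
  merge-cong ν []             eq = eq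
  merge-cong ν ((a , b) ∷ ps) eq = merge-cong _ ps (cong (rename (ν a) (ν b)) eq)

  merge-joins : ∀ (ν : A → Name) ps {a b} → (a , b) ∈ₗ ps → merge ν ps a ≡ merge ν ps b
  merge-joins ν ((a , b) ∷ ps) (here refl) = merge-cong _ ps (rename-joins (ν a) (ν b))
  merge-joins ν ((a , b) ∷ ps) (there i)   = merge-joins _ ps i

  module _ {R : A → A → Set} (R-sym : ∀ {x y} → R x y → R y x) (R-trans : ∀ {x y z} → R x y → R y z → R x z) where

    -- Merging generates the least equivalence relation that contains the pairs and the initial
    -- equalities, so it is contained in any other such `R`. Here `R` will be connection by walks of
    -- zeros.
    merge-sound : ∀ (ν : A → Name) ps → (∀ {x y} → ν x ≡ ν y → R x y) →
                  (∀ {a b} → (a , b) ∈ₗ ps → R a b) → ∀ {x y} → merge ν ps x ≡ merge ν ps y → R x y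
    merge-sound ν []             R-ν R-ps eq = R-ν eq
    merge-sound ν ((a , b) ∷ ps) R-ν R-ps eq = merge-sound _ ps
      (λ eq → Sum.[ R-ν , Sum.[
          (λ (xb , ya) → R-trans (R-ν xb) (R-trans (R-sym (R-ps (here refl))) (R-ν (sym ya)))) ,
          (λ (xa , yb) → R-trans (R-ν xa) (R-trans (R-ps (here refl)) (R-ν (sym yb)))) ] ]
        (rename-≡ (ν a) (ν b) eq))
      (R-ps ∘ there) eq

  ∈-collect⁺ˡ : ∀ (f : Rec {A} → Pairs A) rs {ps p} → p ∈ₗ ps → p ∈ₗ collect f rs ps
  ∈-collect⁺ˡ f []       i = i
  ∈-collect⁺ˡ f (r ∷ rs) i = ∈-collect⁺ˡ f rs (∈-++⁺ʳ (f r) i)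

  ∈-collect⁺ʳ : ∀ (f : Rec {A} → Pairs A) {rs ps r p} → r ∈ₗ rs → p ∈ₗ f r → p ∈ₗ collect f rs ps
  ∈-collect⁺ʳ f {r ∷ rs} (here refl) i = ∈-collect⁺ˡ f rs (∈-++⁺ˡ i)
  ∈-collect⁺ʳ f {r ∷ rs} (there r∈)  i = ∈-collect⁺ʳ f r∈ i

  ∈-collect⁻ : ∀ (f : Rec {A} → Pairs A) rs {ps p} → p ∈ₗ collect f rs ps →
               p ∈ₗ ps ⊎ ∃ λ r → r ∈ₗ rs × p ∈ₗ f r
  ∈-collect⁻ f []       i = inj₁ i
  ∈-collect⁻ f (r ∷ rs) i with ∈-collect⁻ f rs i
  ... | inj₂ (r′ , r′∈ , j) = inj₂ (r′ , there r′∈ , j)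
  ... | inj₁ j with ∈-++⁻ (f r) j
  ...   | inj₁ k = inj₂ (r , here refl , k)
  ...   | inj₂ k = inj₁ k

  -- The first clause says that an edge is not forced to 0 by contraction, the second that no
  -- parallel edge forces it to 1.
  Open : (A → Name) → Pairs A → Pairs A → Set
  Open ν ds us = ∀ {a b} → (a , b) ∈ₗ us →
    ν a ≢ ν b × (∀ {c d} → (c , d) ∈ₗ ds → ¬ (ν c ≡ ν a × ν d ≡ ν b))

  any-matches⁻ : ∀ ν {a b : A} ds → any (matches ν a b) ds ≡ false →
                 ∀ {c d} → (c , d) ∈ₗ ds → ¬ (ν c ≡ ν a × ν d ≡ ν b)
  any-matches⁻ ν {a} {b} ((c , d) ∷ ds) none (here refl) (ca , db)
    with same (ν c) (ν a) | same (ν d) (ν b) | subst (λ v → same (ν c) v ≡ true) ca (same-refl (ν c))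
       | subst (λ v → same (ν d) v ≡ true) db (same-refl (ν d))
  ... | true | true | _ | _ = contradiction none λ ()
  any-matches⁻ ν {a} {b} ((c , d) ∷ ds) none (there i) with matches ν a b (c , d)
  ... | false = any-matches⁻ ν ds none i
  ... | true  = contradiction none λ ()

  any-matches⁺ : ∀ ν {a b : A} ds → (∀ {c d} → (c , d) ∈ₗ ds → ¬ (ν c ≡ ν a × ν d ≡ ν b)) →
                 any (matches ν a b) ds ≡ false
  any-matches⁺ ν         []             none = refl
  any-matches⁺ ν {a} {b} ((c , d) ∷ ds) none with same (ν c) (ν a) in ca | same (ν d) (ν b) in db
  ... | true  | true  = contradiction (same⇒≡ _ _ ca , same⇒≡ _ _ db) (none (here refl))
  ... | true  | false = any-matches⁺ ν ds (none ∘ there)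
  ... | false | _     = any-matches⁺ ν ds (none ∘ there)

  open-pairs⁻ : ∀ ν ds us → open-pairs {A} ν ds us ≡ true → Open ν ds us
  open-pairs⁻ ν ds ((a , b) ∷ us) eq i with same (ν a) (ν b) in ab | any (matches ν a b) ds in hits | i
  ... | false | false | here refl =
    (λ νa≡νb → contradiction (trans (sym ab) (subst (λ v → same (ν a) v ≡ true) νa≡νb (same-refl (ν a)))) λ ()) ,
    any-matches⁻ ν ds hits
  ... | false | false | there j = open-pairs⁻ ν ds us eq j

  open-pairs⁺ : ∀ ν ds us → Open ν ds us → open-pairs {A} ν ds us ≡ true
  open-pairs⁺ ν ds []             op = refl
  open-pairs⁺ ν ds ((a , b) ∷ us) op with same (ν a) (ν b) in ab
  ... | true  = contradiction (same⇒≡ _ _ ab) (proj₁ (op (here refl)))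
  ... | false rewrite any-matches⁺ ν {a} {b} ds (proj₂ (op (here refl))) = open-pairs⁺ ν ds us (op ∘ there)

  all-admissible⁻ : ∀ (rs : List (Rec {A})) → all admissible rs ≡ true → ∀ {r} → r ∈ₗ rs → admissible r ≡ true
  all-admissible⁻ (r ∷ rs) eq (here refl) with admissible r
  ... | true = refl
  all-admissible⁻ (r ∷ rs) eq (there i) with admissible r
  ... | true = all-admissible⁻ rs eq i

  all-admissible⁺ : ∀ (rs : List (Rec {A})) → (∀ {r} → r ∈ₗ rs → admissible r ≡ true) → all admissible rs ≡ true
  all-admissible⁺ []       adm = refl
  all-admissible⁺ (r ∷ rs) adm rewrite adm (here refl) = all-admissible⁺ rs (adm ∘ there)

-- Node names and the encoding of the input

digits : ℕᵇ → Name
digits ℕᵇ.zero  = []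
digits 1+[2 b ] = false ∷ digits b
digits 2[1+ b ] = true ∷ digits b

digits-injective : ∀ a b → digits a ≡ digits b → a ≡ b
digits-injective ℕᵇ.zero  ℕᵇ.zero  eq = refl
digits-injective 1+[2 a ] 1+[2 b ] eq = cong 1+[2_] (digits-injective a b (cong (List.drop 1) eq))
digits-injective 2[1+ a ] 2[1+ b ] eq = cong 2[1+_] (digits-injective a b (cong (List.drop 1) eq))

encode-digits : ∀ b p → encodeℕᵇ b ++ p ≡ tok (digits b) p
encode-digits ℕᵇ.zero  p = refl
encode-digits 1+[2 b ] p = cong (one ∷_) (encode-digits b p)
encode-digits 2[1+ b ] p = cong (two ∷_) (encode-digits b p)

length-digits-suc : ∀ b → length (digits b) ≤ length (digits (ℕᵇ.suc b))
length-digits-suc ℕᵇ.zero  = z≤n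
length-digits-suc 1+[2 b ] = ≤-refl
length-digits-suc 2[1+ b ] = s≤s (length-digits-suc b)

nameℕ : ℕ → Name
nameℕ = digits ∘ fromℕ

-- A successor never shortens a numeral; `fromℕ'` is the conversion by repeated successor, which
-- permits induction. This bounds all node names by the number of nodes, which is written out in the
-- input.
length-nameℕ-mono : ∀ {k l} → k ≤ l → length (nameℕ k) ≤ length (nameℕ l)
length-nameℕ-mono {k} {l} k≤l rewrite fromℕ≡fromℕ' k | fromℕ≡fromℕ' l = mono k≤l
  where
  mono : ∀ {k l} → k ≤ l → length (digits (fromℕ' k)) ≤ length (digits (fromℕ' l))
  mono {k} {zero}  z≤n = z≤n
  mono {k} {suc l} k≤l with m≤n⇒m<n∨m≡n k≤l
  ... | inj₁ (s≤s k≤l′) = ≤-trans (mono k≤l′) (length-digits-suc (fromℕ' l))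
  ... | inj₂ refl       = ≤-refl

name : ∀ {n} → Fin n → Name
name = nameℕ ∘ toℕ

name-injective : ∀ {n} {v w : Fin n} → name v ≡ name w → v ≡ w
name-injective {v = v} {w} eq =
  toℕ-injective (fromℕ-injective (digits-injective (fromℕ (toℕ v)) (fromℕ (toℕ w)) eq))

length-tok-suffix : ∀ w p → length p ≤ length (tok w p)
length-tok-suffix []      p = m≤n⇒m≤1+n ≤-refl
length-tok-suffix (d ∷ w) p = m≤n⇒m≤1+n (length-tok-suffix w p)

length-tok-prefix : ∀ w p → length w ≤ length (tok w p)
length-tok-prefix []      p = z≤n
length-tok-prefix (d ∷ w) p = s≤s (length-tok-prefix w p)

length-input : ∀ {A : Set} (ν : A → Name) rs → length rs ≤ length (input ν rs)
length-input ν []                     = z≤n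
length-input ν ((a , b , f , v) ∷ rs) = ≤-trans (s≤s (m≤n⇒m≤1+n (length-input ν rs)))
  (≤-trans (length-tok-suffix (ν b) _) (length-tok-suffix (ν a) _))

module _ (I : Input) where
  open Input I
  open Graph G′
  open Walks G′

  toRec : Fin m → Rec {Fin n}
  toRec e = proj₁ (ends e) , proj₂ (ends e) , lookup E e , x̃ e

  records : List (Rec {Fin n})
  records = map toRec (allFin m)

  encode-records : encode I ≡ tok (nameℕ n) (input name records)
  encode-records = trans (encode-digits (fromℕ n) _) (cong (tok (nameℕ n)) (edges-encoded (allFin m)))
    where
    edges-encoded : ∀ es → concatMap (encodeEdge I) es ≡ input name (map toRec es)
    edges-encoded []       = refl
    edges-encoded (e ∷ es) = begin
      (encodeℕᵇ a ++ encodeℕᵇ b ++ c ∷ d ∷ []) ++ rest   ≡⟨ ++-assoc (encodeℕᵇ a) _ _ ⟩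
      encodeℕᵇ a ++ (encodeℕᵇ b ++ c ∷ d ∷ []) ++ rest   ≡⟨ cong (encodeℕᵇ a ++_) (++-assoc (encodeℕᵇ b) _ _) ⟩
      encodeℕᵇ a ++ encodeℕᵇ b ++ c ∷ d ∷ rest           ≡⟨ encode-digits a _ ⟩
      tok (digits a) (encodeℕᵇ b ++ c ∷ d ∷ rest)        ≡⟨ cong (tok (digits a)) (encode-digits b _) ⟩
      tok (digits a) (tok (digits b) (c ∷ d ∷ rest))     ≡⟨ cong (λ p → tok (digits a) (tok (digits b) (c ∷ d ∷ p)))
                                                              (edges-encoded es) ⟩
      input name (map toRec (e ∷ es))                  ∎
      where
      open ≡-Reasoning
      a b : ℕᵇ
      a = fromℕ (toℕ (proj₁ (ends e)))
      b = fromℕ (toℕ (proj₂ (ends e)))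
      c d : Symbol
      c = encodeFlag (lookup E e)
      d = encodeValue (x̃ e)
      rest : List Symbol
      rest = concatMap (encodeEdge I) es

  length-nameℕ≤ : length (nameℕ n) ≤ length (encode I)
  length-nameℕ≤ = subst (λ w → length (nameℕ n) ≤ length w) (sym encode-records) (length-tok-prefix (nameℕ n) _)

  length-name≤ : ∀ v → length (name v) ≤ length (encode I)
  length-name≤ v = ≤-trans (length-nameℕ-mono {l = n} (<⇒≤ (toℕ<n v))) length-nameℕ≤

  length-records≤ : length records ≤ length (encode I)
  length-records≤ = subst (λ w → length records ≤ length w) (sym encode-records)
    (≤-trans (length-input name records) (length-tok-suffix (nameℕ n) _))

  private
    zs ds us : Pairs (Fin n)
    zs = collect zerosOf records []
    ds = collect onesOf records []
    us = collect undecOf records []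

    ρ : Fin n → Name
    ρ = merge name zs

    record∈ : ∀ e → toRec e ∈ₗ records
    record∈ e = ∈-map⁺ toRec (∈-allFin e)

  zeros⁺ : ∀ {e} → x̃ e ≡ just 0F → (proj₂ (ends e) , proj₁ (ends e)) ∈ₗ zs
  zeros⁺ {e} eq = ∈-collect⁺ʳ zerosOf (record∈ e) (helper eq)
    where
    helper : ∀ {a b f v} → v ≡ just 0F → (b , a) ∈ₗ zerosOf {Fin n} (a , b , f , v)
    helper refl = here refl

  zeros⁻ : ∀ {a b} → (a , b) ∈ₗ zs → ∃ λ e → x̃ e ≡ just 0F × Joins G′ e a b
  zeros⁻ i with ∈-collect⁻ zerosOf records i
  ... | inj₂ (_ , r∈ , j) with e , _ , refl ← ∈-map⁻ toRec r∈ with x̃ e in eq | j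
  ...   | just 0F | here refl = e , eq , inj₂ refl

  ones⁺ : ∀ {e a b} → x̃ e ≡ just 1F → Joins G′ e a b → (a , b) ∈ₗ ds
  ones⁺ {e} eq j = ∈-collect⁺ʳ onesOf (record∈ e) (helper eq j)
    where
    helper : ∀ {p f v a b} → v ≡ just 1F → p ≡ (a , b) ⊎ p ≡ (b , a) →
             (a , b) ∈ₗ onesOf {Fin n} (proj₁ p , proj₂ p , f , v)
    helper refl (inj₁ refl) = here refl
    helper refl (inj₂ refl) = there (here refl)

  ones⁻ : ∀ {a b} → (a , b) ∈ₗ ds → ∃ λ e → x̃ e ≡ just 1F × Joins G′ e a b
  ones⁻ i with ∈-collect⁻ onesOf records i
  ... | inj₂ (_ , r∈ , j) with e , _ , refl ← ∈-map⁻ toRec r∈ with x̃ e in eq | j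
  ...   | just 1F | here refl         = e , eq , inj₁ refl
  ...   | just 1F | there (here refl) = e , eq , inj₂ refl

  undec⁺ : ∀ {e} → x̃ e ≡ nothing → (proj₂ (ends e) , proj₁ (ends e)) ∈ₗ us
  undec⁺ {e} eq = ∈-collect⁺ʳ undecOf (record∈ e) (helper eq)
    where
    helper : ∀ {a b f v} → v ≡ nothing → (b , a) ∈ₗ undecOf {Fin n} (a , b , f , v)
    helper refl = here refl

  undec⁻ : ∀ {a b} → (a , b) ∈ₗ us → ∃ λ e → x̃ e ≡ nothing × Joins G′ e a b
  undec⁻ i with ∈-collect⁻ undecOf records i
  ... | inj₂ (_ , r∈ , j) with e , _ , refl ← ∈-map⁻ toRec r∈ with x̃ e in eq | j
  ...   | nothing | here refl = e , eq , inj₂ refl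

  -- Stated without reference to the promise, so that a single machine can test it in both cases.
  Criterion : Set
  Criterion = (∀ e → x̃ e ≡ nothing → e ∈ E) × Open ρ ds us

  accepts⁻ : accepts name records ≡ true → Criterion
  accepts⁻ eq with all admissible records in adm
  ... | true = (λ e x̃e → lookup⇒[]= e E (flagged x̃e (all-admissible⁻ records adm (record∈ e)))) ,
               open-pairs⁻ ρ ds us eq
    where
    flagged : ∀ {a b : Fin n} {f v} → v ≡ nothing → admissible (a , b , f , v) ≡ true → f ≡ true
    flagged {f = true} refl _ = refl

  accepts⁺ : Criterion → accepts name records ≡ true
  accepts⁺ (flags , op) = cong₂ _∧_ (all-admissible⁺ records admits) (open-pairs⁺ ρ ds us op)
    where
    admissible⁺ : ∀ {a b : Fin n} f v → (v ≡ nothing → f ≡ true) → admissible (a , b , f , v) ≡ true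
    admissible⁺ true  v        _ = refl
    admissible⁺ false (just _) _ = refl
    admissible⁺ false nothing  h = h refl
    admits : ∀ {r} → r ∈ₗ records → admissible r ≡ true
    admits r∈ with e , _ , refl ← ∈-map⁻ toRec r∈ =
      admissible⁺ (lookup E e) (x̃ e) (λ x̃e → []=⇒lookup (flags e x̃e))

  joins⇒≢ : ∀ {e a b} → Joins G′ e a b → a ≢ b
  joins⇒≢ {e} (inj₁ j) refl = <-irrefl (trans (cong proj₁ j) (sym (cong proj₂ j))) (ordered e)
  joins⇒≢ {e} (inj₂ j) refl = <-irrefl (trans (cong proj₁ j) (sym (cong proj₂ j))) (ordered e)

  -- The case E = E′

  module _ (full : ∀ e → e ∈ E) where

    module _ {x} (completes : X[_] G′ E x̃ x) where

      private
        x∈X = proj₁ completes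
        extends = proj₂ completes

      -- Connection by zeros of x is an equivalence relation that contains every contracted edge,
      -- because x extends x̃.
      connected⇒zero-walk : ∀ {a b} → ρ a ≡ ρ b → WalkIn {S = E} (Zero x) a b
      connected⇒zero-walk = merge-sound (walk-sym (Zero x)) (walk-trans (Zero x)) name zs
        (λ eq → subst (WalkIn (Zero x) _) (name-injective eq) ([] , []))
        (λ i → let e , x̃e , j = zeros⁻ i in walk-edge (Zero x) (full e) j (extends e 0F x̃e))

      connected⇒zero : ∀ {e a b} → Joins G′ e a b → ρ a ≡ ρ b → x e ≡ 0F
      connected⇒zero {e} j eq = zero-walk⇒zero x∈X (full e) j (joins⇒≢ j) (connected⇒zero-walk eq)

      one⇒separated : ∀ {e a b} → x̃ e ≡ just 1F → Joins G′ e a b → ρ a ≢ ρ b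
      one⇒separated {e} x̃e j eq = contradiction (trans (sym (extends e 1F x̃e)) (connected⇒zero j eq)) λ ()

      -- Otherwise e would complete a path of zeros between the ends of f.
      parallel-one⇒one : ∀ {e f a b c d} → Joins G′ e a b → x̃ f ≡ just 1F → Joins G′ f c d →
                         ρ c ≡ ρ a → ρ d ≡ ρ b → x e ≡ 1F
      parallel-one⇒one {e} {f} j x̃f k ca db with x e in xe
      ... | 1F = refl
      ... | 0F = contradiction (trans (sym (extends f 1F x̃f)) (zero-walk⇒zero x∈X (full f) k (joins⇒≢ k)
        (walk-trans (Zero x) (connected⇒zero-walk ca)
          (walk-trans (Zero x) (walk-edge (Zero x) (full e) j xe)
            (walk-sym (Zero x) (connected⇒zero-walk db)))))) λ ()

    -- An edge outside the domain that violates a clause of `Open` has the same label in all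
    -- completions, hence is decided, contrary to maximal specificity.
    specific⇒criterion : MaximallySpecific I → Criterion
    specific⇒criterion specific = (λ e _ → full e) , λ i →
      let e , x̃e , j = undec⁻ i in
      (λ eq → undecided x̃e (λ x x′ h h′ → trans (connected⇒zero h j eq) (sym (connected⇒zero h′ j eq)))) ,
      (λ k (ca , db) → let f , x̃f , j′ = ones⁻ k in
        undecided x̃e (λ x x′ h h′ →
          trans (parallel-one⇒one h j x̃f j′ ca db) (sym (parallel-one⇒one h′ j x̃f j′ ca db))))
      where
      undecided : ∀ {e} → x̃ e ≡ nothing → ¬ Decided G′ E x̃ e
      undecided {e} x̃e decided with _ , x̃e′ ← specific e decided = contradiction (trans (sym x̃e) x̃e′) λ ()

    module _ (g : Fin n → Name) where

      -- The multicut of the partition into the fibres of `g`.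
      labelling : Fin m → Fin 2
      labelling e = if same (g (proj₁ (ends e))) (g (proj₂ (ends e))) then 0F else 1F

      labelling-zero⁻ : ∀ e → labelling e ≡ 0F → Level g e
      labelling-zero⁻ e eq with same (g (proj₁ (ends e))) (g (proj₂ (ends e))) in eq′
      ... | true = level-joined g {e} (inj₁ refl) (same⇒≡ _ _ eq′)

      labelling-zero⁺ : ∀ e → Level g e → labelling e ≡ 0F
      labelling-zero⁺ e lev rewrite lev (joins-ends e) | same-refl (g (proj₂ (ends e))) = refl

      labelling-one : ∀ e → ¬ Level g e → labelling e ≡ 1F
      labelling-one e ¬lev with labelling e in eq
      ... | 0F = contradiction (λ {a} {b} → labelling-zero⁻ e eq {a} {b}) ¬lev
      ... | 1F = refl

      labelling∈ : (∀ e → x̃ e ≡ just 0F → Level g e) → (∀ e → x̃ e ≡ just 1F → ¬ Level g e) →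
                   X[_] G′ E x̃ labelling
      labelling∈ zeros-level ones-separated = labelling∈X g full labelling-zero⁻ labelling-zero⁺ , extends
        where
        extends : ∀ e b → x̃ e ≡ just b → labelling e ≡ b
        extends e 0F x̃e = labelling-zero⁺ e (zeros-level e x̃e)
        extends e 1F x̃e = labelling-one e (ones-separated e x̃e)

    -- An edge e outside the domain is labelled 1 by the finest completion,
    -- and 0 by the completion which merges the two components that e joins.
    criterion⇒specific : Criterion → MaximallySpecific I
    criterion⇒specific (_ , op) e decided with x̃ e in x̃e
    ... | just b  = b , refl
    ... | nothing = contradiction
      (trans (sym (labelling-one ρ e (λ lev → a≢b (sym (lev (joins-ends e))))))
        (trans (decided _ _ finest merged)
          (labelling-zero⁺ ρ′ e (level-joined ρ′ {e} (inj₂ refl) (rename-joins (ρ a) (ρ b)))))) λ ()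
      where
      -- The ends in the order in which `undecOf` lists them.
      a b : Fin n
      a = proj₂ (ends e)
      b = proj₁ (ends e)
      a≢b : ρ a ≢ ρ b
      a≢b = proj₁ (op (undec⁺ x̃e))
      ρ′ : Fin n → Name
      ρ′ = rename (ρ a) (ρ b) ∘ ρ
      zeros-equal : ∀ f → x̃ f ≡ just 0F → Level ρ f
      zeros-equal f x̃f = level-joined ρ {f} (inj₂ refl) (merge-joins name zs (zeros⁺ x̃f))
      -- Consistency enters here: a given completion would have to label f with 0 if contraction had
      -- identified its ends.
      ones-apart : ∀ f → x̃ f ≡ just 1F → ¬ Level ρ f
      ones-apart f x̃f lev =
        one⇒separated (proj₂ consistent) x̃f (joins-ends f) (lev (joins-ends f))
      finest : X[_] G′ E x̃ (labelling ρ)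
      finest = labelling∈ ρ zeros-equal ones-apart
      -- An edge labelled 1 that becomes level was level before or joins the two merged components.
      -- The latter is excluded by `Open` in either orientation, since `ds` contains both.
      merged : X[_] G′ E x̃ (labelling ρ′)
      merged = labelling∈ ρ′ (λ f x̃f j → cong (rename (ρ a) (ρ b)) (zeros-equal f x̃f j)) λ f x̃f lev →
        Sum.[ one⇒separated (proj₂ consistent) x̃f (joins-ends f) , Sum.[
            (λ (cb , da) → proj₂ (op (undec⁺ x̃e)) (ones⁺ x̃f (joins-sym {f} (joins-ends f))) (da , cb)) ,
            (λ (ca , db) → proj₂ (op (undec⁺ x̃e)) (ones⁺ x̃f (joins-ends f)) (ca , db)) ] ]
          (rename-≡ (ρ a) (ρ b) (lev (joins-ends f)))

  -- The case E ⊆ dom x̃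

  module _ (E⊆dom : ∀ e → e ∈ E → e ∈dom x̃) where

    all-decided : ∀ e → Decided G′ E x̃ e
    all-decided e x x′ (x∈X , extends) (x′∈X , extends′) = agree-on-E⇒agree x∈X x′∈X
      (λ f f∈E → let b , x̃f = E⊆dom f f∈E in trans (extends f b x̃f) (sym (extends′ f b x̃f))) e

    -- With all edges decided, maximal specificity leaves no edge outside the domain, and both parts
    -- hold vacuously.
    specific⇒criterion′ : MaximallySpecific I → Criterion
    specific⇒criterion′ specific =
      (λ e x̃e → contradiction x̃e (in-domain e)) ,
      (λ i → let e , x̃e , _ = undec⁻ i in contradiction x̃e (in-domain e))
      where
      in-domain : ∀ e → x̃ e ≢ nothing
      in-domain e x̃e with _ , x̃e′ ← specific e (all-decided e) = contradiction (trans (sym x̃e) x̃e′) λ ()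

    criterion⇒specific′ : Criterion → MaximallySpecific I
    criterion⇒specific′ (flags , _) e _ with x̃ e in x̃e
    ... | just b  = b , refl
    ... | nothing = subst (λ v → ∃ λ b → v ≡ just b) x̃e (E⊆dom e (flags e x̃e))

  criterion⇔specific : E ≡ ⊤ ⊎ (∀ e → e ∈ E → e ∈dom x̃) → Criterion ⇔ MaximallySpecific I
  criterion⇔specific (inj₁ E≡⊤)   = mk⇔ (criterion⇒specific full) (specific⇒criterion full)
    where
    full : ∀ e → e ∈ E
    full e = subst (e ∈_) (sym E≡⊤) ∈⊤
  criterion⇔specific (inj₂ E⊆dom) = mk⇔ (criterion⇒specific′ E⊆dom) (specific⇒criterion′ E⊆dom)

lemma7 : DecidableInPolynomialTime encode
    (λ I → let open Input I in E ≡ ⊤ ⊎ (∀ e → e ∈ E → e ∈dom x̃))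
    MaximallySpecific
lemma7 = toTM decider , 10000 , 3 , λ I promise →
  -- The length of the input bounds the lengths of names and the number of edges at once.
  let L         = length (encode I)
      _ , run   = run-decider L name (length-name≤ I) (nameℕ (Graph.n (Input.G′ I))) (length-nameℕ≤ I)
                    (records I) (length-records≤ I)
      criterion = criterion⇔specific I promise
  in accepts name (records I) ,
     answers-initial decider (from cong (λ w → w Vec.∷ Vec.replicate 9 []) (sym (encode-records I)) , run)
       (10000 * L ^ 3 + 10000) (run-time L) ,
     mk⇔ (Equivalence.to criterion ∘ accepts⁻ I) (accepts⁺ I ∘ Equivalence.from criterion)
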